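{- For every positive integer $\lambda$, there are only finitely many nontrivial graphical $t$-$\bigl(\binom{n}{2}, k, \lambda\bigr)$ designs with $t \geq 2$ (here $n$, $t$, $k$ range over all positive integers with $t\ge 2$, and designs may have repeated blocks).
   Context: For positive integers $t,\lambda$, an integer $k \ge t$ and a set $X$ of cardinality $v$, a $t$-$(v,k,\lambda)$ design is a pair $(X,\mathcal{B})$, where $\mathcal{B}$ is a finite multiset of $k$-subsets of $X$ such that every $t$-subset of $X$ is contained in exactly $\lambda$ members of $\mathcal{B}$, counted with multiplicity. The multiplicity of a $k$-subset $B$ in $\mathcal{B}$ is denoted $\mu_{\mathcal{B}}(B)$. The design is empty if $\mu_{\mathcal{B}}(B)=0$ for every $k$-subset $B$ of $X$; it contains the complete design if $\mu_{\mathcal{B}}(B)\ge 1$ for every $k$-subset $B$ of $X$. It is nontrivial if $t<k<v$ and it neither is empty nor contains the complete design. For each $n$, fix an $n$-element set $V$; $K_n$ is the complete graph with vertex set $V$, and $X=E(K_n)=\binom{V}{2}$ is the set of all $2$-subsets of $V$. The symmetric group $\mathrm{Sym}(V)$ acts on $X$ by $\sigma(\{x,y\})=\{\sigma(x),\sigma(y)\}$ and on subsets of $X$ elementwise. A $t$-$\bigl(\binom n2,k,\lambda\bigr)$ design on $X=E(K_n)$ is graphical if $\mu_{\mathcal{B}}(\sigma(B))=\mu_{\mathcal{B}}(B)$ for all $\sigma\in\mathrm{Sym}(V)$ and all $k$-subsets $B$ of $X$. -}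

module Defs where

open import Data.Bool.Base using (Bool; if_then_else_)
import Data.Bool.Properties as Bool
open import Data.Fin.Base using (Fin; zero)
open import Data.Fin.Permutation as Perm
  using (Permutation; _⟨$⟩ʳ_; _⟨$⟩ˡ_)
open import Data.Fin.Properties using (+↔⊎)
open import Data.Fin.Subset using (Subset; inside; outside; ∣_∣; ⊥)
open import Data.Fin.Subset.Properties using (_⊆?_; ∣⊥∣≡0)
open import Data.List.Base using (List; length; filter)
open import Data.List.Relation.Binary.Permutation.Propositional
  using (_↭_; ↭-refl; ↭-sym; ↭-trans)
open import Data.Nat.Base using (ℕ; zero; suc; _+_; _≤_; _<_; z≤n)
open import Data.Nat.Combinatorics
  using (_C_; nCk≡nC[n∸k]; nCn≡1; nCk+nC[k+1]≡[n+1]C[k+1])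
import Data.Nat.Properties as ℕ
open import Data.Product.Base using (Σ; _×_; _,_; proj₁)
import Data.Product.Properties as Product
open import Data.Sum.Base using (_⊎_; inj₁; inj₂)
open import Data.Sum.Function.Propositional using (_⊎-↔_)
open import Data.Vec.Base using ([]; _∷_; lookup; tabulate)
import Data.Vec.Properties as Vec
open import Algebra.Properties.CommutativeMonoid.Sum ℕ.+-0-commutativeMonoid
  using (sum; sum-permute; sum-cong-≗)
open import Function.Base using (_∘_)
open import Function.Bundles using (_↔_; mk↔ₛ′; Inverse)
open import Function.Properties.Inverse using (↔-sym; ↔-trans)
open import Relation.Binary.Bundles using (Setoid)
open import Relation.Binary.Definitions using (DecidableEquality)
open import Relation.Binary.PropositionalEquality
  using (_≡_; refl; sym; trans; cong; module ≡-Reasoning)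
open import Relation.Nullary.Decidable using (yes)
open import Relation.Nullary.Negation using (¬_)

KSubset : ℕ → ℕ → Set
KSubset n k = Σ (Subset n) λ p → ∣ p ∣ ≡ k

KSubset-≡ : ∀ {n k} {p q : KSubset n k} → proj₁ p ≡ proj₁ q → p ≡ q
KSubset-≡ {p = p , e} {q = .p , f} refl = cong (p ,_) (ℕ.≡-irrelevant e f)

infix 4 _≟_

_≟_ : ∀ {n k} → DecidableEquality (KSubset n k)
_≟_ = Product.≡-dec (Vec.≡-dec Bool._≟_) λ e f → yes (ℕ.≡-irrelevant e f)

-- Pascal's rule as a bijection: a (k+1)-subset of Fin (n+1) either contains
-- zero or it does not.

pascal : ∀ n k → KSubset (suc n) (suc k) ↔ (KSubset n k ⊎ KSubset n (suc k))
pascal n k = mk↔ₛ′ to from to∘from from∘to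
  where
  to : KSubset (suc n) (suc k) → KSubset n k ⊎ KSubset n (suc k)
  to (inside  ∷ p , e) = inj₁ (p , ℕ.suc-injective e)
  to (outside ∷ p , e) = inj₂ (p , e)

  from : KSubset n k ⊎ KSubset n (suc k) → KSubset (suc n) (suc k)
  from (inj₁ (p , e)) = inside  ∷ p , cong suc e
  from (inj₂ (p , e)) = outside ∷ p , e

  to∘from : ∀ s → to (from s) ≡ s
  to∘from (inj₁ p) = cong inj₁ (KSubset-≡ refl)
  to∘from (inj₂ p) = refl

  from∘to : ∀ p → from (to p) ≡ p
  from∘to (inside  ∷ p , e) = KSubset-≡ refl
  from∘to (outside ∷ p , e) = refl

KSubset-0 : ∀ n → KSubset n 0 ↔ Fin 1
KSubset-0 n = mk↔ₛ′ (λ _ → zero) (λ _ → ⊥ , ∣⊥∣≡0 n)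
                    (λ { zero → refl })
                    (λ (p , e) → KSubset-≡ (sym (∣p∣≡0⇒p≡⊥ p e)))
  where
  ∣p∣≡0⇒p≡⊥ : ∀ {n} (p : Subset n) → ∣ p ∣ ≡ 0 → p ≡ ⊥
  ∣p∣≡0⇒p≡⊥ []            _ = refl
  ∣p∣≡0⇒p≡⊥ (outside ∷ p) e = cong (outside ∷_) (∣p∣≡0⇒p≡⊥ p e)

KSubset↔Fin : ∀ n k → KSubset n k ↔ Fin (n C k)
KSubset↔Fin n       zero    = ↔-trans (KSubset-0 n) (Perm.cast-id (sym (nC0≡1 n)))
  where
  nC0≡1 : ∀ n → n C 0 ≡ 1
  nC0≡1 n = trans (nCk≡nC[n∸k] {0} {n} z≤n) (nCn≡1 n)
KSubset↔Fin zero    (suc k) = mk↔ₛ′ (λ { ([] , ()) }) (λ ()) (λ ()) (λ { ([] , ()) })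
KSubset↔Fin (suc n) (suc k) =
  ↔-trans (pascal n k)
  (↔-trans (KSubset↔Fin n k ⊎-↔ KSubset↔Fin n (suc k))
  (↔-trans (↔-sym +↔⊎)
           (Perm.cast-id (nCk+nC[k+1]≡[n+1]C[k+1] n k))))

-- π(p) elementwise: y ∈ π(p) iff π⁻¹(y) ∈ p
image : ∀ {n} → Permutation n n → Subset n → Subset n
image π p = tabulate λ y → lookup p (π ⟨$⟩ˡ y)

∣image∣ : ∀ {n} (π : Permutation n n) (p : Subset n) → ∣ image π p ∣ ≡ ∣ p ∣
∣image∣ π p = begin
  ∣ image π p ∣                       ≡⟨ ∣∣-sum (image π p) ⟩
  sum (bit ∘ lookup (image π p))      ≡⟨ sum-cong-≗ (cong bit ∘ Vec.lookup∘tabulate (lookup p ∘ (π ⟨$⟩ˡ_))) ⟩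
  sum (bit ∘ lookup p ∘ (π ⟨$⟩ˡ_))    ≡⟨ sum-permute (bit ∘ lookup p) (Perm.flip π) ⟨
  sum (bit ∘ lookup p)                ≡⟨ ∣∣-sum p ⟨
  ∣ p ∣                               ∎
  where
  open ≡-Reasoning

  bit : Bool → ℕ
  bit b = if b then 1 else 0

  ∣∣-sum : ∀ {n} (p : Subset n) → ∣ p ∣ ≡ sum (bit ∘ lookup p)
  ∣∣-sum []            = refl
  ∣∣-sum (inside  ∷ p) = cong suc (∣∣-sum p)
  ∣∣-sum (outside ∷ p) = ∣∣-sum p

image-flip : ∀ {n} (π : Permutation n n) (p : Subset n) → image (Perm.flip π) (image π p) ≡ p
image-flip π p = trans
  (Vec.tabulate-cong λ x → trans (Vec.lookup∘tabulate _ (π ⟨$⟩ʳ x))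
                                 (cong (lookup p) (Perm.inverseˡ π)))
  (Vec.tabulate∘lookup p)

act : ∀ {n k} → Permutation n n → KSubset n k ↔ KSubset n k
act π = mk↔ₛ′ (move π) (move (Perm.flip π))
              (λ (p , _) → KSubset-≡ (image-flip (Perm.flip π) p))
              (λ (p , _) → KSubset-≡ (image-flip π p))
  where
  move : ∀ {n k} → Permutation n n → KSubset n k → KSubset n k
  move π (p , e) = image π p , trans (∣image∣ π p) e

infixr 8 _·_

_·_ : ∀ {n k} → Permutation n n → KSubset n k → KSubset n k
π · p = Inverse.to (act π) p

-- Designs on a v-set, taken to be Fin v.  Lists of blocks represent
-- multisets; they are compared up to _↭_ below.

μ : ∀ {v k} → List (KSubset v k) → KSubset v k → ℕ
μ 𝓑 B = length (filter (_≟ B) 𝓑)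

record Design (t v k Λ : ℕ) : Set where
  field
    t>0      : 0 < t
    Λ>0      : 0 < Λ
    t≤k      : t ≤ k
    blocks   : List (KSubset v k)
    balanced : (T : KSubset v t) →
               length (filter (λ B → proj₁ T ⊆? proj₁ B) blocks) ≡ Λ

open Design public using (blocks)

module _ {t v k Λ : ℕ} (D : Design t v k Λ) where

  Empty : Set
  Empty = (B : KSubset v k) → μ (blocks D) B ≡ 0

  ContainsComplete : Set
  ContainsComplete = (B : KSubset v k) → 1 ≤ μ (blocks D) B

  Nontrivial : Set
  Nontrivial = t < k × k < v × ¬ Empty × ¬ ContainsComplete

-- The vertex set of K_n is Fin n.  The point set of a design on E(K_n) is
-- Fin (n C 2), identified with E n through KSubset↔Fin.

E : ℕ → Set
E n = KSubset n 2

onEdges : ∀ {n} → Permutation n n → Permutation (n C 2) (n C 2)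
onEdges {n} σ = ↔-trans (↔-sym (KSubset↔Fin n 2)) (↔-trans (act σ) (KSubset↔Fin n 2))

Graphical : ∀ {t k Λ} n → Design t (n C 2) k Λ → Set
Graphical {k = k} n D = (σ : Permutation n n) (B : KSubset (n C 2) k) →
  μ (blocks D) (onEdges σ · B) ≡ μ (blocks D) B

record NontrivialGraphicalDesign (Λ : ℕ) : Set where
  constructor mkNGD
  field
    n t k      : ℕ
    t≥2        : 2 ≤ t
    design     : Design t (n C 2) k Λ
    graphical  : Graphical n design
    nontrivial : Nontrivial design

-- Two designs are the same when they have the same n, t and k and the same
-- multiset of blocks; isomorphic designs are not identified.

infix 4 _≈_

data _≈_ {Λ : ℕ} : (D D′ : NontrivialGraphicalDesign Λ) → Set where
  same : ∀ {n t k t≥2 t≥2′ D D′ g g′ nt nt′} → blocks D ↭ blocks D′ →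
         mkNGD n t k t≥2 D g nt ≈ mkNGD n t k t≥2′ D′ g′ nt′

nontrivialGraphicalDesigns : ℕ → Setoid _ _
nontrivialGraphicalDesigns Λ = record
  { Carrier       = NontrivialGraphicalDesign Λ
  ; _≈_           = _≈_
  ; isEquivalence = record
    { refl  = same ↭-refl
    ; sym   = λ { (same p) → same (↭-sym p) }
    ; trans = λ { (same p) (same q) → same (↭-trans p q) }
    }
  }

{-# OPTIONS --safe #-}

-- Let D be a nontrivial graphical t-design with t ≥ 2 and v = n C 2.  If v ≤ t + k, then inclusion–exclusion
-- over the complement of a block shows that all multiplicities agree, so D is empty or contains the
-- complete design; hence t + k < v.
--
-- Suppose that T is a t-set contained in a block B, and that the transpositions (x p), for more than Λ
-- vertices x, fix T but not B.  The images of B under them are then distinct blocks containing T, which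
-- contradicts balance.  So every large set of interchangeable vertices ("twins") of T consists mostly of
-- twins of B.
--
-- Choose a set Vs of vertices such that t exceeds the number of edges not inside Vs by at least 2 and at most
-- about |Vs|; as 2t < v, Vs is large when n is.  Let T₀ consist of all edges not inside Vs, two disjoint edges
-- inside Vs, and further edges inside Vs that bring their number to t and leave most vertices of Vs isolated
-- there.  Let B be a block containing T₀.  Most vertices of Vs are twins in B of a single vertex p.  If x is not a twin of p, then removing from B the edges
-- inside Vs at x and at Λ + 1 twins of p must leave fewer than t edges, that is,
-- k - t < deg x + (Λ + 1) deg p.  But B has at least about |Vs| · deg p edges outside T₀, so deg p ≤ 1;
-- deg p = 1 would make B a star inside Vs, and deg p = 0 fails at one of the leaves of T₀.
-- Therefore |Vs|, and with it n, is bounded in terms of Λ, and the finitely many remaining candidates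
-- can be searched.

module Submission where

open import Defs
open import Algebra.Properties.CommutativeSemigroup using (x∙yz≈y∙xz)
import Data.Bool.Properties as Bool
open import Data.Empty using (⊥)
open import Data.Fin.Base using (Fin; zero; suc)
open import Data.Fin.Permutation as Perm using (Permutation; permutation; transpose; _⟨$⟩ʳ_; _⟨$⟩ˡ_)
import Data.Fin.Permutation.Components as PC
import Data.Fin.Properties as Fin
open import Data.Fin.Subset as Subset using (Subset; inside; outside; ∣_∣; _∈_; _∉_; _⊆_; _∪_; ⁅_⁆; ∁)
open import Data.Fin.Subset.Properties
open import Data.List.Base as List
  using (List; []; _∷_; [_]; _++_; length; filter; map; take; allFin; upTo; cartesianProductWith; concatMap)
import Data.List.Membership.DecPropositional as DecMembership
open import Data.List.Membership.Propositional using (find; lose) renaming (_∈_ to _∈ₗ_; _∉_ to _∉ₗ_)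
open import Data.List.Membership.Propositional.Properties
import Data.List.Properties as List
open import Data.List.Relation.Binary.Permutation.Propositional using (↭-refl)
open import Data.List.Relation.Unary.All as All using (All; []; _∷_)
import Data.List.Relation.Unary.All.Properties as All
open import Data.List.Relation.Unary.AllPairs as AllPairs using ([]; _∷_)
open import Data.List.Relation.Unary.Any using (Any; here; there)
import Data.List.Relation.Unary.Any.Properties as Any
open import Data.List.Relation.Unary.Enumerates.Setoid using (IsEnumeration)
open import Data.List.Relation.Unary.Unique.Propositional using (Unique)
import Data.List.Relation.Unary.Unique.Propositional.Properties as Unique
open import Data.Nat.Base using (ℕ; zero; suc; _+_; _*_; _∸_; _≤_; _<_; z≤n; s≤s; s≤s⁻¹)
open import Data.Nat.Combinatorics using (_C_; nC1≡n; nCk+nC[k+1]≡[n+1]C[k+1])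
open import Data.Nat.DivMod using (_/_; _%_; m*n/n≡m; m≡m%n+[m/n]*n; m/n*n≤m; m%n<n)
open import Data.Nat.ListAction using (sum)
import Data.Nat.Properties as ℕ
open import Data.Nat.Tactic.RingSolver using (solve-∀)
open import Data.Product.Base using (∃; ∃₂; Σ-syntax; _×_; _,_; proj₁; proj₂; swap)
open import Data.Sum.Base as Sum using (_⊎_; inj₁; inj₂; [_,_]′)
open import Data.Vec.Base using (Vec; []; _∷_; here; there; lookup; tabulate)
import Data.Vec.Properties as Vec
open import Function.Base using (_∘_; id)
open import Function.Bundles using (Inverse)
open import Level using (Level)
open import Relation.Binary.PropositionalEquality
  using (_≡_; _≢_; refl; sym; trans; cong; cong₂; subst; subst₂; ≢-sym; module ≡-Reasoning)
open import Relation.Nullary.Decidable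
  using (Dec; yes; no; does; dec-true; map′; decidable-stable; ¬?; _×-dec_; _⊎-dec_; _→-dec_)
open import Relation.Nullary.Negation using (¬_; contradiction)
open import Relation.Unary using (Pred; Decidable)

-- Lists without repetitions and their lengths.

module _ {a : Level} {A : Set a} where

  unique-⊆-length : {xs ys : List A} → Unique xs → (∀ {x} → x ∈ₗ xs → x ∈ₗ ys) →
                    length xs ≤ length ys
  unique-⊆-length {[]} _ _ = z≤n
  unique-⊆-length {x ∷ xs} (x≢ ∷ u) xs⊆ys with ∈-∃++ (xs⊆ys (here refl))
  ... | as , bs , refl = begin
    suc (length xs)              ≤⟨ s≤s (unique-⊆-length u xs⊆as++bs) ⟩
    suc (length (as ++ bs))      ≡⟨ cong suc (List.length-++ as) ⟩
    suc (length as + length bs)  ≡⟨ ℕ.+-suc (length as) (length bs) ⟨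
    length as + suc (length bs)  ≡⟨ List.length-++ as ⟨
    length (as ++ x ∷ bs)        ∎
    where
    open ℕ.≤-Reasoning

    xs⊆as++bs : ∀ {y} → y ∈ₗ xs → y ∈ₗ as ++ bs
    xs⊆as++bs {y} y∈xs with ∈-++⁻ as (xs⊆ys (there y∈xs))
    ... | inj₁ y∈as           = ∈-++⁺ˡ y∈as
    ... | inj₂ (here refl)    = contradiction refl (All.lookup x≢ y∈xs)
    ... | inj₂ (there y∈bs)   = ∈-++⁺ʳ as y∈bs

  unique-++ˡ : ∀ xs {ys : List A} → Unique (xs ++ ys) → Unique xs
  unique-++ˡ []       _        = []
  unique-++ˡ (x ∷ xs) (x≢ ∷ u) = All.tabulate (λ y∈ → All.lookup x≢ (∈-++⁺ˡ y∈)) ∷ unique-++ˡ xs u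

  unique-++ʳ : ∀ xs {ys : List A} → Unique (xs ++ ys) → Unique ys
  unique-++ʳ []       u       = u
  unique-++ʳ (x ∷ xs) (_ ∷ u) = unique-++ʳ xs u

  unique-++-disjoint : ∀ xs {ys : List A} → Unique (xs ++ ys) → ∀ {x} → x ∈ₗ xs → x ∉ₗ ys
  unique-++-disjoint (x ∷ xs) (x≢ ∷ _) (here refl)  x∈ys = All.lookup x≢ (∈-++⁺ʳ xs x∈ys) refl
  unique-++-disjoint (x ∷ xs) (_ ∷ u)  (there x∈xs) x∈ys = unique-++-disjoint xs u x∈xs x∈ys

  splitAt-length : ∀ m {o} (xs : List A) → length xs ≡ m + o →
                   ∃₂ λ ys zs → xs ≡ ys ++ zs × length ys ≡ m × length zs ≡ o
  splitAt-length zero    xs       e = [] , xs , refl , refl , e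
  splitAt-length (suc m) (x ∷ xs) e with splitAt-length m xs (ℕ.suc-injective e)
  ... | ys , zs , refl , p , q = x ∷ ys , zs , refl , cong suc p , q

  length-filter-∁ : ∀ {p} {P : Pred A p} (P? : Decidable P) (Q? : Decidable (λ x → ¬ P x)) (xs : List A) →
                    length xs ≡ length (filter P? xs) + length (filter Q? xs)
  length-filter-∁ P? Q? [] = refl
  length-filter-∁ P? Q? (x ∷ xs) with P? x | Q? x
  ... | yes p | yes ¬p = contradiction p ¬p
  ... | yes p | no _   = cong suc (length-filter-∁ P? Q? xs)
  ... | no ¬p | yes _  = trans (cong suc (length-filter-∁ P? Q? xs)) (sym (ℕ.+-suc _ _))
  ... | no ¬p | no ¬¬p = contradiction ¬p ¬¬p

length-cartesianProductWith : ∀ {A B C : Set} (f : A → B → C) xs ys →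
  length (List.cartesianProductWith f xs ys) ≡ length xs * length ys
length-cartesianProductWith f []       ys = refl
length-cartesianProductWith f (x ∷ xs) ys = trans (List.length-++ (map (f x) ys))
  (cong₂ _+_ (List.length-map (f x) ys) (length-cartesianProductWith f xs ys))

map-unique : ∀ {A B : Set} (f : A → B) {xs} → Unique xs →
             (∀ {x y} → x ∈ₗ xs → y ∈ₗ xs → f x ≡ f y → x ≡ y) → Unique (map f xs)
map-unique f {[]}     _        inj = []
map-unique f {x ∷ xs} (x≢ ∷ u) inj =
  All.tabulate (λ fy∈ e → let y , y∈ , fy≡ = ∈-map⁻ f fy∈ in
                 All.lookup x≢ y∈ (inj (here refl) (there y∈) (trans e fy≡)))
  ∷ map-unique f u λ x∈ y∈ → inj (there x∈) (there y∈)

cartesianProductWith-unique : ∀ {A B C : Set} (f : A → B → C) {xs ys} → Unique xs → Unique ys →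
  (∀ {a b c d} → a ∈ₗ xs → b ∈ₗ ys → c ∈ₗ xs → d ∈ₗ ys → f a b ≡ f c d → a ≡ c × b ≡ d) →
  Unique (List.cartesianProductWith f xs ys)
cartesianProductWith-unique f {[]} ux uy inj = []
cartesianProductWith-unique f {x ∷ xs} {ys} (x≢ ∷ ux) uy inj =
  Unique.++⁺ (map-unique (f x) uy λ b∈ d∈ e → proj₂ (inj (here refl) b∈ (here refl) d∈ e))
             (cartesianProductWith-unique f ux uy λ a b c d → inj (there a) b (there c) d)
             λ (v∈ , v∈′) →
    let b , b∈ , v≡ = ∈-map⁻ (f x) v∈
        c , d , c∈ , d∈ , v≡′ = ∈-cartesianProductWith⁻ f xs ys v∈′
    in All.lookup x≢ c∈ (proj₁ (inj (here refl) b∈ (there c∈) d∈ (trans (sym v≡) v≡′)))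

-- Finite subsets, their lists of elements, and sets of intermediate size.

elements : ∀ {n} → Subset n → List (Fin n)
elements []            = []
elements (inside  ∷ p) = zero ∷ map suc (elements p)
elements (outside ∷ p) = map suc (elements p)

length-elements : ∀ {n} (p : Subset n) → length (elements p) ≡ ∣ p ∣
length-elements []            = refl
length-elements (inside  ∷ p) = cong suc (trans (List.length-map suc (elements p)) (length-elements p))
length-elements (outside ∷ p) = trans (List.length-map suc (elements p)) (length-elements p)

elements-unique : ∀ {n} (p : Subset n) → Unique (elements p)
elements-unique []            = []
elements-unique (inside  ∷ p) =
  All.tabulate (λ x∈ 0≡x → let _ , _ , x≡ = ∈-map⁻ suc x∈ in Fin.0≢1+n (trans 0≡x x≡))
  ∷ Unique.map⁺ Fin.suc-injective (elements-unique p)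
elements-unique (outside ∷ p) = Unique.map⁺ Fin.suc-injective (elements-unique p)

∈-elements⁺ : ∀ {n} {p : Subset n} {x} → x ∈ p → x ∈ₗ elements p
∈-elements⁺ {p = inside  ∷ p} here        = here refl
∈-elements⁺ {p = inside  ∷ p} (there x∈p) = there (∈-map⁺ suc (∈-elements⁺ x∈p))
∈-elements⁺ {p = outside ∷ p} (there x∈p) = ∈-map⁺ suc (∈-elements⁺ x∈p)

∈-elements⁻ : ∀ {n} {p : Subset n} {x} → x ∈ₗ elements p → x ∈ p
∈-elements⁻ {p = inside  ∷ p} (here refl) = here
∈-elements⁻ {p = inside  ∷ p} (there x∈) with ∈-map⁻ suc x∈
... | _ , y∈ , refl = there (∈-elements⁻ y∈)
∈-elements⁻ {p = outside ∷ p} x∈ with ∈-map⁻ suc x∈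
... | _ , y∈ , refl = there (∈-elements⁻ y∈)

subset : ∀ {n p} {P : Pred (Fin n) p} → Decidable P → Subset n
subset P? = tabulate (does ∘ P?)

∈-subset⁺ : ∀ {n p} {P : Pred (Fin n) p} (P? : Decidable P) {x} → P x → x ∈ subset P?
∈-subset⁺ P? {x} px =
  Vec.lookup⇒[]= x _ (trans (Vec.lookup∘tabulate (does ∘ P?) x) (dec-true (P? x) px))

∈-subset⁻ : ∀ {n p} {P : Pred (Fin n) p} (P? : Decidable P) {x} → x ∈ subset P? → P x
∈-subset⁻ P? {x} x∈ with P? x in eq
... | yes px = px
... | no _   = contradiction
  (trans (cong does (sym eq)) (trans (sym (Vec.lookup∘tabulate (does ∘ P?) x)) (Vec.[]=⇒lookup x∈)))
  λ ()

-- Elements of `q` outside `p` are dropped as long as the rest of `q` still has `m` elements. At the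
-- first one where it has fewer, `m` is exactly the size of what is left of `q`, and all of that is
-- taken.
interpolate : ∀ {n m} (p q : Subset n) → p ⊆ q → ∣ p ∣ ≤ m → m ≤ ∣ q ∣ →
              ∃ λ r → p ⊆ r × r ⊆ q × ∣ r ∣ ≡ m
interpolate {m = m} [] [] _ _ z≤n = [] , (λ ()) , (λ ()) , refl
interpolate (inside ∷ p) (outside ∷ q) p⊆q _ _ with p⊆q here
... | ()
interpolate {m = suc m} (inside ∷ p) (inside ∷ q) p⊆q (s≤s p≤m) (s≤s m≤q)
  with interpolate p q (drop-∷-⊆ p⊆q) p≤m m≤q
... | r , p⊆r , r⊆q , e = inside ∷ r , s⊆s p⊆r , s⊆s r⊆q , cong suc e
interpolate (outside ∷ p) (outside ∷ q) p⊆q p≤m m≤q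
  with interpolate p q (drop-∷-⊆ p⊆q) p≤m m≤q
... | r , p⊆r , r⊆q , e = outside ∷ r , s⊆s p⊆r , s⊆s r⊆q , e
interpolate {m = m} (outside ∷ p) (inside ∷ q) p⊆q p≤m m≤q with ℕ.m≤n⇒m<n∨m≡n m≤q
... | inj₁ (s≤s m≤q′) with interpolate p q (drop-∷-⊆ p⊆q) p≤m m≤q′
...   | r , p⊆r , r⊆q , e = outside ∷ r , s⊆s p⊆r , out⊆ r⊆q , e
interpolate {m = m} (outside ∷ p) (inside ∷ q) p⊆q p≤m m≤q | inj₂ e =
  inside ∷ q , p⊆q , id , sym e

-- Counting by cases and double counting.

module _ {a : Level} {A : Set a} where

  unique-length-≡ : {xs ys : List A} → Unique xs → Unique ys →
                    (∀ {x} → x ∈ₗ xs → x ∈ₗ ys) → (∀ {x} → x ∈ₗ ys → x ∈ₗ xs) →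
                    length xs ≡ length ys
  unique-length-≡ u v xs⊆ys ys⊆xs = ℕ.≤-antisym (unique-⊆-length u xs⊆ys) (unique-⊆-length v ys⊆xs)

  length-filter-≐ : ∀ {p q} {P : Pred A p} {Q : Pred A q} (P? : Decidable P) (Q? : Decidable Q)
                    (xs : List A) → (∀ {x} → P x → Q x) → (∀ {x} → Q x → P x) →
                    length (filter P? xs) ≡ length (filter Q? xs)
  length-filter-≐ P? Q? xs f g = cong length (List.filter-≐ P? Q? (f , g) xs)

  length-filter-⊎ : ∀ {p q r} {P : Pred A p} {Q : Pred A q} {R : Pred A r}
                    (P? : Decidable P) (Q? : Decidable Q) (R? : Decidable R) →
                    (∀ {x} → P x → Q x ⊎ R x) → (∀ {x} → Q x → P x) → (∀ {x} → R x → P x) →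
                    (∀ {x} → Q x → ¬ R x) → ∀ xs →
                    length (filter P? xs) ≡ length (filter Q? xs) + length (filter R? xs)
  length-filter-⊎ P? Q? R? P⇒ Q⇒P R⇒P Q⇒¬R [] = refl
  length-filter-⊎ P? Q? R? P⇒ Q⇒P R⇒P Q⇒¬R (x ∷ xs)
    with length-filter-⊎ P? Q? R? P⇒ Q⇒P R⇒P Q⇒¬R xs | P? x | Q? x | R? x
  ... | ih | yes p | yes q | yes r = contradiction r (Q⇒¬R q)
  ... | ih | yes p | yes q | no ¬r = cong suc ih
  ... | ih | yes p | no ¬q | yes r = trans (cong suc ih) (sym (ℕ.+-suc _ _))
  ... | ih | yes p | no ¬q | no ¬r = contradiction (P⇒ p) [ ¬q , ¬r ]′
  ... | ih | no ¬p | yes q | _     = contradiction (Q⇒P q) ¬p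
  ... | ih | no ¬p | no ¬q | yes r = contradiction (R⇒P r) ¬p
  ... | ih | no ¬p | no ¬q | no ¬r = ih

  sum-map-const : ∀ (f : A → ℕ) c (xs : List A) → (∀ {x} → x ∈ₗ xs → f x ≡ c) →
                  sum (map f xs) ≡ length xs * c
  sum-map-const f c []       f≡c = refl
  sum-map-const f c (x ∷ xs) f≡c = cong₂ _+_ (f≡c (here refl)) (sum-map-const f c xs (f≡c ∘ there))

  sum-map-filter : ∀ {p} {P : Pred A p} (P? : Decidable P) (f : A → ℕ) c (xs : List A) →
                   (∀ x → P x → f x ≡ c) → (∀ x → ¬ P x → f x ≡ 0) →
                   sum (map f xs) ≡ length (filter P? xs) * c
  sum-map-filter P? f c []       f≡c f≡0 = refl
  sum-map-filter P? f c (x ∷ xs) f≡c f≡0 with P? x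
  ... | yes p = cong₂ _+_ (f≡c x p) (sum-map-filter P? f c xs f≡c f≡0)
  ... | no ¬p = cong₂ _+_ (f≡0 x ¬p) (sum-map-filter P? f c xs f≡c f≡0)

module _ {a b p : Level} {A : Set a} {B : Set b} {P : A → B → Set p} (P? : ∀ x y → Dec (P x y)) where

  -- The incidence table is built up row by row. It is applied to points against blocks in
  -- `count-step` and to t-sets against blocks in `length-blocks`.
  double-count : ∀ (xs : List A) (ys : List B) →
                 sum (map (λ x → length (filter (P? x) ys)) xs) ≡
                 sum (map (λ y → length (filter (λ x → P? x y) xs)) ys)
  double-count []       ys = sym (trans (sum-map-const _ 0 ys λ _ → refl) (ℕ.*-zeroʳ (length ys)))
  double-count (x ∷ xs) ys = trans (cong (length (filter (P? x) ys) +_) (double-count xs ys)) (add-row ys)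
    where
    swap-front = x∙yz≈y∙xz ℕ.+-commutativeSemigroup

    column : B → ℕ
    column y = length (filter (λ x → P? x y) xs)

    add-row : ∀ ys → length (filter (P? x) ys) + sum (map column ys)
                   ≡ sum (map (λ y → length (filter (λ x → P? x y) (x ∷ xs))) ys)
    add-row [] = refl
    add-row (y ∷ ys) with P? x y
    ... | yes _ = cong suc (trans (swap-front (length (filter (P? x) ys)) (column y) _) (cong (column y +_) (add-row ys)))
    ... | no _  = trans (swap-front (length (filter (P? x) ys)) (column y) _) (cong (column y +_) (add-row ys))

⊆∧∣∣≡⇒≡ : ∀ {n} {p q : Subset n} → p ⊆ q → ∣ p ∣ ≡ ∣ q ∣ → p ≡ q
⊆∧∣∣≡⇒≡ {p = p} p⊆q e = ⊆-antisym p⊆q λ {x} x∈q → case-∈ x x∈q (x ∈? p)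
  where
  case-∈ : ∀ x → x ∈ _ → Dec (x ∈ p) → x ∈ p
  case-∈ x x∈q (yes x∈p) = x∈p
  case-∈ x x∈q (no x∉p)  = contradiction e (ℕ.<⇒≢ (p⊂q⇒∣p∣<∣q∣ (p⊆q , x , x∈q , x∉p)))

-- Block intersection numbers

module BlockCounts {t v k Λ : ℕ} (t<k : t < k) (bs : List (KSubset v k))
  (balanced : (T : KSubset v t) → length (filter (λ B → proj₁ T ⊆? proj₁ B) bs) ≡ Λ) where

  open DecMembership (Fin._≟_ {v}) using () renaming (_∈?_ to _∈ₗ?_)

  Meets : List (Fin v) → List (Fin v) → KSubset v k → Set
  Meets is js B = All (_∈ proj₁ B) is × All (_∉ proj₁ B) js

  meets? : ∀ is js → Decidable (Meets is js)
  meets? is js B = All.all? (_∈? proj₁ B) is ×-dec All.all? (λ x → ¬? (x ∈? proj₁ B)) js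

  count : List (Fin v) → List (Fin v) → ℕ
  count is js = length (filter (meets? is js) bs)

  others : List (Fin v) → List (Fin v)
  others is = filter (λ x → ¬? (x ∈ₗ? is)) (allFin v)

  others-unique : ∀ is → Unique (others is)
  others-unique is = Unique.filter⁺ _ (Unique.allFin⁺ v)

  ∈-others⁻ : ∀ is {x} → x ∈ₗ others is → x ∉ₗ is
  ∈-others⁻ is x∈ = proj₂ (∈-filter⁻ (λ x → ¬? (x ∈ₗ? is)) {xs = allFin v} x∈)

  filter-others : ∀ {is} {P : Fin v → Set} (P? : Decidable P) (p : Subset v) → Unique is →
                  (∀ {x} → P x → x ∈ p) → (∀ {x} → x ∈ p → P x) → (∀ {x} → x ∈ₗ is → x ∈ p) →
                  length (filter P? (others is)) ≡ ∣ p ∣ ∸ length is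
  filter-others {is} P? p u P⇒ ⇒P is⊆p = begin
    length xs                               ≡⟨ ℕ.m+n∸n≡m (length xs) (length is) ⟨
    length xs + length is ∸ length is       ≡⟨ cong (_∸ length is) (List.length-++ xs) ⟨
    length (xs ++ is) ∸ length is           ≡⟨ cong (_∸ length is) (unique-length-≡
                                                 (Unique.++⁺ (Unique.filter⁺ P? (others-unique is)) u disjoint)
                                                 (elements-unique p) to from) ⟩
    length (elements p) ∸ length is         ≡⟨ cong (_∸ length is) (length-elements p) ⟩
    ∣ p ∣ ∸ length is                       ∎
    where
    open ≡-Reasoning
    xs = filter P? (others is)

    disjoint : ∀ {x} → ¬ (x ∈ₗ xs × x ∈ₗ is)
    disjoint (x∈xs , x∈is) = ∈-others⁻ is (proj₁ (∈-filter⁻ P? {xs = others is} x∈xs)) x∈is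

    to : ∀ {x} → x ∈ₗ xs ++ is → x ∈ₗ elements p
    to x∈ with ∈-++⁻ xs x∈
    ... | inj₁ x∈xs = ∈-elements⁺ (P⇒ (proj₂ (∈-filter⁻ P? {xs = others is} x∈xs)))
    ... | inj₂ x∈is = ∈-elements⁺ (is⊆p x∈is)

    from : ∀ {x} → x ∈ₗ elements p → x ∈ₗ xs ++ is
    from {x} x∈ with x ∈ₗ? is
    ... | yes x∈is = ∈-++⁺ʳ xs x∈is
    ... | no x∉is  = ∈-++⁺ˡ (∈-filter⁺ P? (∈-filter⁺ _ (∈-allFin x) x∉is) (⇒P (∈-elements⁻ x∈)))

  length-others : ∀ {is} → Unique is → length (others is) ≡ v ∸ length is
  length-others {is} u = begin
    length (others is)                       ≡⟨ cong length (List.filter-all all? {others is} (All.tabulate λ _ → ∈⊤)) ⟨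
    length (filter all? (others is))         ≡⟨ filter-others all? Subset.⊤ u id id (λ _ → ∈⊤) ⟩
    ∣ Subset.⊤ {v} ∣ ∸ length is    ≡⟨ cong (_∸ length is) (∣⊤∣≡n v) ⟩
    v ∸ length is                            ∎
    where
    open ≡-Reasoning
    all? : Decidable (_∈ Subset.⊤)
    all? x = x ∈? Subset.⊤

  -- Counting the pairs of a point x and a block containing x ∷ is.
  count-step : ∀ {is} → Unique is →
               sum (map (λ x → count (x ∷ is) []) (others is)) ≡ count is [] * (k ∸ length is)
  count-step {is} u = trans (double-count (λ x B → meets? (x ∷ is) [] B) (others is) bs)
    (sum-map-filter (meets? is []) _ (k ∸ length is) bs in-block not-in-block)
    where
    in-block : ∀ B → Meets is [] B → length (filter (λ x → meets? (x ∷ is) [] B) (others is)) ≡ k ∸ length is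
    in-block B (is⊆B , _) = trans
      (filter-others (λ x → meets? (x ∷ is) [] B) (proj₁ B) u
        (λ { (x∈B ∷ _ , _) → x∈B }) (λ x∈B → x∈B ∷ is⊆B , []) (All.lookup is⊆B))
      (cong (_∸ length is) (proj₂ B))

    not-in-block : ∀ B → ¬ Meets is [] B → length (filter (λ x → meets? (x ∷ is) [] B) (others is)) ≡ 0
    not-in-block B is⊈B = cong length
      (List.filter-none (λ x → meets? (x ∷ is) [] B) {others is}
        (All.tabulate λ { _ (_ ∷ is⊆B , _) → is⊈B (is⊆B , []) }))

  -- A t-design is an s-design for every s ≤ t, by induction on `j` = t - s. Counting pairs of a
  -- further point and a block through it and `is` gives λ(s) (k - s) = (v - s) λ(s+1). The constant
  -- is chosen before `is`, so it depends on s alone.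
  count-const₀ : ∀ j → ∃ λ c → ∀ is → Unique is → length is + j ≡ t → count is [] ≡ c
  count-const₀ zero = Λ , λ is u e →
    let T = subset (_∈ₗ? is)
        is⊆T : ∀ {x} → x ∈ₗ is → x ∈ T
        is⊆T = ∈-subset⁺ (_∈ₗ? is)
        ∣T∣≡t = trans (sym (length-elements T)) (trans
          (unique-length-≡ (elements-unique T) u (∈-subset⁻ (_∈ₗ? is) ∘ ∈-elements⁻) (∈-elements⁺ ∘ is⊆T))
          (trans (sym (ℕ.+-identityʳ _)) e))
    in trans (length-filter-≐ (meets? is []) (λ B → T ⊆? proj₁ B) bs
                (λ (is⊆B , _) x∈T → All.lookup is⊆B (∈-subset⁻ (_∈ₗ? is) x∈T))
                (λ T⊆B → All.tabulate (T⊆B ∘ is⊆T) , []))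
             (balanced (T , ∣T∣≡t))
  count-const₀ (suc j) with count-const₀ j
  -- The divisor `suc (k ∸ suc i)` is k - i, written so that it is visibly nonzero; i < k holds
  -- because i ≤ t < k.
  ... | c , count≡c = (v ∸ i) * c / suc (k ∸ suc i) , λ is u e →
    let i≡ = trans (sym (ℕ.m+n∸n≡m (length is) (suc j))) (cong (_∸ suc j) e)
        i<k = ℕ.≤-<-trans (ℕ.m∸n≤m t (suc j)) t<k
        step : count is [] * suc (k ∸ suc i) ≡ (v ∸ i) * c
        step = begin
          count is [] * suc (k ∸ suc i)                      ≡⟨ cong (count is [] *_) (ℕ.+-∸-assoc 1 i<k) ⟨
          count is [] * (k ∸ i)                              ≡⟨ cong (λ i → count is [] * (k ∸ i)) i≡ ⟨
          count is [] * (k ∸ length is)                      ≡⟨ count-step u ⟨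
          sum (map (λ x → count (x ∷ is) []) (others is))    ≡⟨ sum-map-const _ c (others is) (λ x∈ →
                                                                count≡c _ (All.tabulate (λ y∈is x≡y →
                                                                  ∈-others⁻ is x∈ (subst (_∈ₗ is) (sym x≡y) y∈is)) ∷ u)
                                                                (trans (sym (ℕ.+-suc (length is) j)) e)) ⟩
          length (others is) * c                             ≡⟨ cong (_* c) (length-others u) ⟩
          (v ∸ length is) * c                                ≡⟨ cong (λ i → (v ∸ i) * c) i≡ ⟩
          (v ∸ i) * c                                        ∎
    in trans (sym (m*n/n≡m (count is []) (suc (k ∸ suc i)))) (cong (_/ suc (k ∸ suc i)) step)
    where
    open ≡-Reasoning
    i = t ∸ suc j

  -- Inclusion-exclusion, one avoided point at a time: the blocks that contain `is` and avoid `js`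
  -- are split according to whether they contain the next point `y`, and two of the three counts are
  -- constant by induction.
  count-const : ∀ j {i} → i + j ≤ t →
                ∃ λ c → ∀ is js → Unique (js ++ is) → length js ≡ j → length is ≡ i → count is js ≡ c
  count-const zero {i} i≤t with count-const₀ (t ∸ i)
  ... | c , count≡c = c , λ { is [] u _ refl → count≡c is u (ℕ.m+[n∸m]≡n (subst (_≤ t) (ℕ.+-identityʳ i) i≤t)) }
  count-const (suc j) {i} i+j≤t
    with count-const j {i} (ℕ.≤-trans (ℕ.+-monoʳ-≤ i (ℕ.n≤1+n j)) i+j≤t)
       | count-const j {suc i} (subst (_≤ t) (ℕ.+-suc i j) i+j≤t)
  ... | c , count≡c | c′ , count≡c′ = c ∸ c′ , λ { is (y ∷ js) (y≢ ∷ u) e e′ →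
    let e″ = ℕ.suc-injective e
        y∉js : All (y ≢_) js
        y∉js = All.tabulate λ x∈ → All.lookup y≢ (∈-++⁺ˡ x∈)
        u′ : Unique (js ++ y ∷ is)
        u′ = Unique.++⁺ (unique-++ˡ js u)
               (All.tabulate (λ x∈ → All.lookup y≢ (∈-++⁺ʳ js x∈)) ∷ unique-++ʳ js u)
               (λ { (x∈js , here refl) → All.lookup y∉js x∈js refl
                  ; (x∈js , there x∈is) → unique-++-disjoint js u x∈js x∈is })
    in begin
      count is (y ∷ js)                                     ≡⟨ ℕ.m+n∸m≡n (count (y ∷ is) js) _ ⟨
      count (y ∷ is) js + count is (y ∷ js) ∸ count (y ∷ is) js
        ≡⟨ cong (_∸ count (y ∷ is) js) (length-filter-⊎ (meets? is js) (meets? (y ∷ is) js) (meets? is (y ∷ js))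
             (λ {B} (p , q) → split B p q (y ∈? proj₁ B))
             (λ { (_ ∷ p , q) → p , q }) (λ { (p , _ ∷ q) → p , q })
             (λ { (y∈B ∷ _ , _) (_ , y∉B ∷ _) → y∉B y∈B }) bs) ⟨
      count is js ∸ count (y ∷ is) js                       ≡⟨ cong₂ _∸_ (count≡c is js u e″ e′) (count≡c′ (y ∷ is) js u′ e″ (cong suc e′)) ⟩
      c ∸ c′                                                ∎ }
    where
    open ≡-Reasoning

    split : ∀ {y is js} B → All (_∈ proj₁ B) is → All (_∉ proj₁ B) js → Dec (y ∈ proj₁ B) →
            Meets (y ∷ is) js B ⊎ Meets is (y ∷ js) B
    split B p q (yes y∈B) = inj₁ (y∈B ∷ p , q)
    split B p q (no y∉B)  = inj₂ (p , y∉B ∷ q)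

  -- As all blocks have k points, a block equals `B` as soon as it avoids the complement of `B`.
  -- That complement has v - k ≤ t points, so the multiplicity of `B` is an intersection number with
  -- nothing prescribed and v - k points avoided.
  μ-const : v ≤ t + k → ∃ λ c → ∀ B → μ bs B ≡ c
  μ-const v≤t+k with count-const (v ∸ k) {0} (subst (v ∸ k ≤_) (ℕ.m+n∸n≡m t k) (ℕ.∸-monoˡ-≤ k v≤t+k))
  ... | c , count≡c = c , λ B → trans
    (length-filter-≐ (_≟ B) (meets? [] (elements (∁ (proj₁ B)))) bs
      (λ { refl → [] , All.tabulate (x∈∁p⇒x∉p ∘ ∈-elements⁻) })
      (λ {B′} (_ , avoids) → KSubset-≡ (⊆∧∣∣≡⇒≡
        (λ {x} x∈B′ → inside-B B B′ avoids x∈B′ (x ∈? proj₁ B))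
        (trans (proj₂ B′) (sym (proj₂ B))))))
    (count≡c [] (elements (∁ (proj₁ B)))
      (subst Unique (sym (List.++-identityʳ _)) (elements-unique (∁ (proj₁ B))))
      (trans (length-elements (∁ (proj₁ B))) (trans (∣∁p∣≡n∸∣p∣ (proj₁ B)) (cong (v ∸_) (proj₂ B)))) refl)
    where
    inside-B : ∀ B B′ → All (_∉ proj₁ B′) (elements (∁ (proj₁ B))) → ∀ {x} → x ∈ proj₁ B′ →
               Dec (x ∈ proj₁ B) → x ∈ proj₁ B
    inside-B B B′ avoids x∈B′ (yes x∈B) = x∈B
    inside-B B B′ avoids x∈B′ (no x∉B)  =
      contradiction x∈B′ (All.lookup avoids (∈-elements⁺ (x∉p⇒x∈∁p x∉B)))

-- Exhaustive search

length≤sum-map : ∀ {a} {A : Set a} (f : A → ℕ) (xs : List A) → (∀ x → 1 ≤ f x) → length xs ≤ sum (map f xs)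
length≤sum-map f []       f≥1 = z≤n
length≤sum-map f (x ∷ xs) f≥1 = ℕ.+-mono-≤ (f≥1 x) (length≤sum-map f xs f≥1)

∀-dec : ∀ {A : Set} {p} (P : Pred A p) (xs : List A) → (∀ x → x ∈ₗ xs) → Decidable P → Dec (∀ x → P x)
∀-dec P xs complete P? = map′ (λ all x → All.lookup all (complete x)) (λ f → All.tabulate λ {x} _ → f x) (All.all? P? xs)

any-concatMap⁺ : ∀ {A B : Set} {p} {P : Pred B p} (f : A → List B) {xs} →
                 Any (λ x → Any P (f x)) xs → Any P (concatMap f xs)
any-concatMap⁺ f = Any.concat⁺ ∘ Any.map⁺

kSubsets : ∀ v k → List (KSubset v k)
kSubsets v k = map (Inverse.from (KSubset↔Fin v k)) (allFin (v C k))

∈-kSubsets : ∀ {v k} (p : KSubset v k) → p ∈ₗ kSubsets v k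
∈-kSubsets {v} {k} p = subst (_∈ₗ kSubsets v k) (Inverse.strictlyInverseʳ (KSubset↔Fin v k) p)
  (∈-map⁺ _ (∈-allFin (Inverse.to (KSubset↔Fin v k) p)))

vecs : ∀ n m → List (Vec (Fin n) m)
vecs n zero    = [ [] ]
vecs n (suc m) = cartesianProductWith _∷_ (allFin n) (vecs n m)

∈-vecs : ∀ {n m} (xs : Vec (Fin n) m) → xs ∈ₗ vecs n m
∈-vecs []       = here refl
∈-vecs (x ∷ xs) = ∈-cartesianProductWith⁺ _∷_ (∈-allFin x) (∈-vecs xs)

listsUpTo : ∀ {A : Set} → List A → ℕ → List (List A)
listsUpTo xs zero    = [ [] ]
listsUpTo xs (suc l) = [] ∷ cartesianProductWith _∷_ xs (listsUpTo xs l)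

∈-listsUpTo : ∀ {A : Set} (xs : List A) → (∀ x → x ∈ₗ xs) → ∀ {l} ys → length ys ≤ l → ys ∈ₗ listsUpTo xs l
∈-listsUpTo xs complete {zero}  []       _       = here refl
∈-listsUpTo xs complete {suc l} []       _       = here refl
∈-listsUpTo xs complete {suc l} (y ∷ ys) (s≤s p) =
  there (∈-cartesianProductWith⁺ _∷_ (complete y) (∈-listsUpTo xs complete ys p))

image-cong : ∀ {n} (π ρ : Permutation n n) → (∀ y → π ⟨$⟩ˡ y ≡ ρ ⟨$⟩ˡ y) → ∀ p → image π p ≡ image ρ p
image-cong π ρ π≗ρ p = Vec.tabulate-cong λ y → cong (lookup p) (π≗ρ y)

-- Permutations given by the same tables can differ in their proof components, so invariance is
-- transported along pointwise agreement. The inverse of `onEdges π` moves an edge by the forward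
-- map of `π`, so agreement of the forward maps is derived as well.
onEdges-cong : ∀ {n k} (π ρ : Permutation n n) → (∀ y → π ⟨$⟩ˡ y ≡ ρ ⟨$⟩ˡ y) →
               (B : KSubset (n C 2) k) → onEdges π · B ≡ onEdges ρ · B
onEdges-cong {n} π ρ π≗ρ (p , _) = KSubset-≡ (image-cong (onEdges π) (onEdges ρ)
  (λ i → cong (Inverse.to (KSubset↔Fin n 2)) (KSubset-≡ (image-cong (Perm.flip π) (Perm.flip ρ) π≗ρʳ (proj₁ (Inverse.from (KSubset↔Fin n 2) i))))) p)
  where
  π≗ρʳ : ∀ x → π ⟨$⟩ʳ x ≡ ρ ⟨$⟩ʳ x
  π≗ρʳ x = begin
    π ⟨$⟩ʳ x                        ≡⟨ Perm.inverseʳ ρ ⟨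
    ρ ⟨$⟩ʳ (ρ ⟨$⟩ˡ (π ⟨$⟩ʳ x))      ≡⟨ cong (ρ ⟨$⟩ʳ_) (π≗ρ (π ⟨$⟩ʳ x)) ⟨
    ρ ⟨$⟩ʳ (π ⟨$⟩ˡ (π ⟨$⟩ʳ x))      ≡⟨ cong (ρ ⟨$⟩ʳ_) (Perm.inverseˡ π) ⟩
    ρ ⟨$⟩ʳ x                        ∎
    where open ≡-Reasoning

-- Permutations are searched as pairs of mutually inverse tables.
module _ {t k Λ : ℕ} (n : ℕ) (D : Design t (n C 2) k Λ) where

  private
    Invariant : Permutation n n → Set
    Invariant σ = (B : KSubset (n C 2) k) → μ (blocks D) (onEdges σ · B) ≡ μ (blocks D) B

    invariant? : ∀ σ → Dec (Invariant σ)
    invariant? σ = ∀-dec _ (kSubsets (n C 2) k) ∈-kSubsets λ B → μ (blocks D) (onEdges σ · B) ℕ.≟ μ (blocks D) B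

    invariant-cong : ∀ σ τ → (∀ y → σ ⟨$⟩ˡ y ≡ τ ⟨$⟩ˡ y) → Invariant σ → Invariant τ
    invariant-cong σ τ σ≗τ inv B = trans (cong (μ (blocks D)) (sym (onEdges-cong σ τ σ≗τ B))) (inv B)

    -- Quantifying over `l` and `r` makes this meaningful for every pair of tables: it holds
    -- vacuously unless they are inverse to each other.
    Tables : Vec (Fin n) n → Vec (Fin n) n → Set
    Tables f g = (l : ∀ x → lookup f (lookup g x) ≡ x) (r : ∀ x → lookup g (lookup f x) ≡ x) →
                 Invariant (permutation (lookup f) (lookup g) l r)

    tables? : ∀ f g → Dec (Tables f g)
    tables? f g = decide (Fin.all? λ x → lookup f (lookup g x) Fin.≟ x) (Fin.all? λ x → lookup g (lookup f x) Fin.≟ x)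
      where
      decide : Dec (∀ x → lookup f (lookup g x) ≡ x) → Dec (∀ x → lookup g (lookup f x) ≡ x) → Dec (Tables f g)
      decide (no ¬l) _       = yes λ l → contradiction l ¬l
      decide (yes _) (no ¬r) = yes λ _ r → contradiction r ¬r
      decide (yes l) (yes r) = map′
        (λ inv l′ r′ → invariant-cong (permutation (lookup f) (lookup g) l r)
                                      (permutation (lookup f) (lookup g) l′ r′) (λ _ → refl) inv)
        (λ inv → inv l r)
        (invariant? (permutation (lookup f) (lookup g) l r))

    tables⇒graphical : (∀ f g → Tables f g) → Graphical n D
    tables⇒graphical h σ = invariant-cong (permutation (lookup f) (lookup g) l r) σ
                             (Vec.lookup∘tabulate (σ ⟨$⟩ˡ_)) (h f g l r)
      where
      f = tabulate (σ ⟨$⟩ʳ_)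
      g = tabulate (σ ⟨$⟩ˡ_)
      l : ∀ x → lookup f (lookup g x) ≡ x
      l x = trans (Vec.lookup∘tabulate (σ ⟨$⟩ʳ_) (lookup g x))
                  (trans (cong (σ ⟨$⟩ʳ_) (Vec.lookup∘tabulate (σ ⟨$⟩ˡ_) x)) (Perm.inverseʳ σ))
      r : ∀ x → lookup g (lookup f x) ≡ x
      r x = trans (Vec.lookup∘tabulate (σ ⟨$⟩ˡ_) (lookup f x))
                  (trans (cong (σ ⟨$⟩ˡ_) (Vec.lookup∘tabulate (σ ⟨$⟩ʳ_) x)) (Perm.inverseˡ σ))

  graphical? : Dec (Graphical n D)
  graphical? = map′ tables⇒graphical (λ graphical f g l r → graphical (permutation (lookup f) (lookup g) l r))
    (∀-dec (λ f → ∀ g → Tables f g) (vecs n n) ∈-vecs λ f → ∀-dec (Tables f) (vecs n n) ∈-vecs λ g → tables? f g)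

nontrivial? : ∀ {t v k Λ} (D : Design t v k Λ) → Dec (Nontrivial D)
nontrivial? {t} {v} {k} D = t ℕ.<? k ×-dec k ℕ.<? v
  ×-dec ¬? (∀-dec (λ B → μ (blocks D) B ≡ 0) (kSubsets v k) ∈-kSubsets λ B → μ (blocks D) B ℕ.≟ 0)
  ×-dec ¬? (∀-dec (λ B → 1 ≤ μ (blocks D) B) (kSubsets v k) ∈-kSubsets λ B → 1 ℕ.≤? μ (blocks D) B)

-- Every block contains at least one t-set, because t ≤ k, and every t-set lies in Λ blocks. This
-- bounds the lists of blocks to be searched.
length-blocks : ∀ {t v k Λ} (D : Design t v k Λ) → length (blocks D) ≤ length (kSubsets v t) * Λ
length-blocks {t} {v} {k} {Λ} D = begin
  length (blocks D)                                          ≤⟨ length≤sum-map _ (blocks D) contains ⟩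
  sum (map (λ B → length (filter (λ T → proj₁ T ⊆? proj₁ B) (kSubsets v t))) (blocks D))
    ≡⟨ double-count (λ T B → proj₁ T ⊆? proj₁ B) (kSubsets v t) (blocks D) ⟨
  sum (map (λ T → length (filter (λ B → proj₁ T ⊆? proj₁ B) (blocks D))) (kSubsets v t))
    ≡⟨ sum-map-const _ Λ (kSubsets v t) (λ {T} _ → Design.balanced D T) ⟩
  length (kSubsets v t) * Λ                                  ∎
  where
  open ℕ.≤-Reasoning

  contains : ∀ B → 1 ≤ length (filter (λ T → proj₁ T ⊆? proj₁ B) (kSubsets v t))
  contains (p , e) with interpolate Subset.⊥ p ⊥⊆ (subst (_≤ t) (sym (∣⊥∣≡0 v)) z≤n) (subst (t ≤_) (sym e) (Design.t≤k D))
  ... | T , _ , T⊆p , e′ = ∈-length (∈-filter⁺ (λ T → proj₁ T ⊆? p) (∈-kSubsets (T , e′)) T⊆p)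

module _ (Λ : ℕ) where

  IsDesign : (t v k : ℕ) → List (KSubset v k) → Set
  IsDesign t v k bs = 0 < t × 0 < Λ × t ≤ k ×
    ((T : KSubset v t) → length (filter (λ B → proj₁ T ⊆? proj₁ B) bs) ≡ Λ)

  isDesign? : ∀ t v k bs → Dec (IsDesign t v k bs)
  isDesign? t v k bs = 0 ℕ.<? t ×-dec 0 ℕ.<? Λ ×-dec t ℕ.≤? k
    ×-dec ∀-dec _ (kSubsets v t) ∈-kSubsets λ T → length (filter (λ B → proj₁ T ⊆? proj₁ B) bs) ℕ.≟ Λ

  toDesign : ∀ {t v k} bs → IsDesign t v k bs → Design t v k Λ
  toDesign bs (t>0 , Λ>0 , t≤k , balanced) =
    record { t>0 = t>0 ; Λ>0 = Λ>0 ; t≤k = t≤k ; blocks = bs ; balanced = balanced }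

  IsNGD : ∀ n {t k} → Design t (n C 2) k Λ → Set
  IsNGD n {t} D = 2 ≤ t × Graphical n D × Nontrivial D

  isNGD? : ∀ n {t k} (D : Design t (n C 2) k Λ) → Dec (IsNGD n D)
  isNGD? n {t} D = 2 ℕ.≤? t ×-dec graphical? n D ×-dec nontrivial? D

  fromDesign : ∀ n {t k} (D : Design t (n C 2) k Λ) → Dec (IsNGD n D) → List (NontrivialGraphicalDesign Λ)
  fromDesign n D (no _)               = []
  fromDesign n D (yes (t≥2 , g , nt)) = [ mkNGD n _ _ t≥2 D g nt ]

  fromBlocks : ∀ n {t k} bs → Dec (IsDesign t (n C 2) k bs) → List (NontrivialGraphicalDesign Λ)
  fromBlocks n bs (no _)  = []
  fromBlocks n bs (yes d) = fromDesign n (toDesign bs d) (isNGD? n (toDesign bs d))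

  -- The search rebuilds the proof components by decision procedures, and `_≈_` ignores them, so the
  -- design found is the same as `D`. The decision is an argument in order that it can be split on.
  ∈-fromBlocks : ∀ n {t k} t≥2 (D : Design t (n C 2) k Λ) g nt (d? : Dec (IsDesign t (n C 2) k (blocks D))) →
                 Any (mkNGD n t k t≥2 D g nt ≈_) (fromBlocks n (blocks D) d?)
  ∈-fromBlocks n t≥2 D g nt (no ¬d) =
    contradiction (Design.t>0 D , Design.Λ>0 D , Design.t≤k D , Design.balanced D) ¬d
  ∈-fromBlocks n t≥2 D g nt (yes d) = ∈-fromDesign (isNGD? n (toDesign (blocks D) d))
    where
    ∈-fromDesign : (ngd? : Dec (IsNGD n (toDesign (blocks D) d))) →
                   Any (mkNGD n _ _ t≥2 D g nt ≈_) (fromDesign n (toDesign (blocks D) d) ngd?)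
    ∈-fromDesign (no ¬ngd) = contradiction (t≥2 , g , nt) ¬ngd
    ∈-fromDesign (yes _)   = here (same ↭-refl)

  designsWithBlocks : ∀ n t k → List (KSubset (n C 2) k) → List (NontrivialGraphicalDesign Λ)
  designsWithBlocks n t k bs = fromBlocks n bs (isDesign? t (n C 2) k bs)

  -- Since t < k < v, both t and k lie below `n C 2`, and `length-blocks` bounds the lists of
  -- blocks. A bound on n therefore leaves finitely many candidates, each of which is tested.
  enumeration : ∀ N → (∀ (D : NontrivialGraphicalDesign Λ) → NontrivialGraphicalDesign.n D ≤ N) →
                Σ[ Ds ∈ List (NontrivialGraphicalDesign Λ) ] IsEnumeration (nontrivialGraphicalDesigns Λ) Ds
  enumeration N n≤N = designs , λ { (mkNGD n t k t≥2 D g nt@(t<k , k<v , _)) →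
    any-concatMap⁺ withOrder (lose (∈-upTo⁺ (s≤s (n≤N (mkNGD n t k t≥2 D g nt))))
    (any-concatMap⁺ (withStrength n) (lose (∈-upTo⁺ (ℕ.<-trans t<k k<v))
    (any-concatMap⁺ (withBlockSize n t) (lose (∈-upTo⁺ k<v)
    (any-concatMap⁺ (designsWithBlocks n t k)
      (lose (∈-listsUpTo (kSubsets (n C 2) k) ∈-kSubsets (blocks D) (length-blocks D))
            (∈-fromBlocks n t≥2 D g nt (isDesign? t (n C 2) k (blocks D)))))))))) }
    where
    withBlockSize : ℕ → ℕ → ℕ → List (NontrivialGraphicalDesign Λ)
    withBlockSize n t k = concatMap (designsWithBlocks n t k)
      (listsUpTo (kSubsets (n C 2) k) (length (kSubsets (n C 2) t) * Λ))

    withStrength : ℕ → ℕ → List (NontrivialGraphicalDesign Λ)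
    withStrength n t = concatMap (withBlockSize n t) (upTo (n C 2))

    withOrder : ℕ → List (NontrivialGraphicalDesign Λ)
    withOrder n = concatMap (withStrength n) (upTo (n C 2))

    designs = concatMap withOrder (upTo (suc N))

-- Unordered pairs

pair : ∀ {n} → Fin n → Fin n → Subset n
pair x y = ⁅ x ⁆ ∪ ⁅ y ⁆

module _ {n : ℕ} where

  ∈-pair⁻ : ∀ {x y z : Fin n} → z ∈ pair x y → z ≡ x ⊎ z ≡ y
  ∈-pair⁻ {x} {y} z∈ = Sum.map (x∈⁅y⁆⇒x≡y x) (x∈⁅y⁆⇒x≡y y) (x∈p∪q⁻ ⁅ x ⁆ ⁅ y ⁆ z∈)

  ∈-pairˡ : ∀ {x y : Fin n} → x ∈ pair x y
  ∈-pairˡ {x} {y} = x∈p∪q⁺ (inj₁ (x∈⁅x⁆ x))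

  ∈-pairʳ : ∀ {x y : Fin n} → y ∈ pair x y
  ∈-pairʳ {x} {y} = x∈p∪q⁺ (inj₂ (x∈⁅x⁆ y))

  pair-comm : ∀ (x y : Fin n) → pair x y ≡ pair y x
  pair-comm x y = ∪-comm ⁅ x ⁆ ⁅ y ⁆

  pair-injective : ∀ {x y u w : Fin n} → x ≢ y → pair x y ≡ pair u w → (x ≡ u × y ≡ w) ⊎ (x ≡ w × y ≡ u)
  pair-injective {x} {y} {u} {w} x≢y e
    with ∈-pair⁻ (subst (x ∈_) e ∈-pairˡ) | ∈-pair⁻ (subst (y ∈_) e ∈-pairʳ)
  ... | inj₁ x≡u | inj₁ y≡u = contradiction (trans x≡u (sym y≡u)) x≢y
  ... | inj₁ x≡u | inj₂ y≡w = inj₁ (x≡u , y≡w)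
  ... | inj₂ x≡w | inj₁ y≡u = inj₂ (x≡w , y≡u)
  ... | inj₂ x≡w | inj₂ y≡w = contradiction (trans x≡w (sym y≡w)) x≢y

  pair-≡ : ∀ {x y : Fin n} {p} → x ∈ p → y ∈ p → (∀ {z} → z ∈ p → z ≡ x ⊎ z ≡ y) → p ≡ pair x y
  pair-≡ x∈p y∈p p⊆ = ⊆-antisym
    (λ z∈p → [ (λ { refl → ∈-pairˡ }) , (λ { refl → ∈-pairʳ }) ]′ (p⊆ z∈p))
    (λ z∈ → [ (λ { refl → x∈p }) , (λ { refl → y∈p }) ]′ (∈-pair⁻ z∈))

  ∣pair∣ : ∀ {x y : Fin n} → x ≢ y → ∣ pair x y ∣ ≡ 2
  ∣pair∣ {x} {y} x≢y = trans (sym (length-elements (pair x y)))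
    (unique-length-≡ {ys = x ∷ y ∷ []} (elements-unique (pair x y)) ((x≢y ∷ []) ∷ [] ∷ [])
      (λ z∈ → [ (λ z≡x → here z≡x) , (λ z≡y → there (here z≡y)) ]′ (∈-pair⁻ (∈-elements⁻ {p = pair x y} z∈)))
      (λ { (here refl) → ∈-elements⁺ {p = pair x y} ∈-pairˡ ; (there (here refl)) → ∈-elements⁺ {p = pair x y} ∈-pairʳ }))

  ∣p∣≡2⇒pair : ∀ (p : Subset n) → ∣ p ∣ ≡ 2 → ∃₂ λ x y → x ≢ y × p ≡ pair x y
  ∣p∣≡2⇒pair p e = go (elements p) (elements-unique p) (trans (length-elements p) e) ∈-elements⁻ ∈-elements⁺
    where
    go : ∀ xs → Unique xs → length xs ≡ 2 → (∀ {x} → x ∈ₗ xs → x ∈ p) → (∀ {x} → x ∈ p → x ∈ₗ xs) →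
         ∃₂ λ x y → x ≢ y × p ≡ pair x y
    go (x ∷ y ∷ []) ((x≢y ∷ []) ∷ _) _ ⊆p p⊆ = x , y , x≢y , pair-≡ (⊆p (here refl)) (⊆p (there (here refl)))
      λ z∈p → either (p⊆ z∈p)
      where
      either : ∀ {z} → z ∈ₗ x ∷ y ∷ [] → z ≡ x ⊎ z ≡ y
      either (here z≡x)         = inj₁ z≡x
      either (there (here z≡y)) = inj₂ z≡y

-- Images of pairs, and transpositions.

∈-image⁺ : ∀ {n} (π : Permutation n n) {p x} → π ⟨$⟩ˡ x ∈ p → x ∈ image π p
∈-image⁺ π {p} {x} x∈ = Vec.lookup⇒[]= x _
  (trans (Vec.lookup∘tabulate (lookup p ∘ (π ⟨$⟩ˡ_)) x) (Vec.[]=⇒lookup x∈))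

∈-image⁻ : ∀ {n} (π : Permutation n n) {p x} → x ∈ image π p → π ⟨$⟩ˡ x ∈ p
∈-image⁻ π {p} {x} x∈ = Vec.lookup⇒[]= _ p
  (trans (sym (Vec.lookup∘tabulate (lookup p ∘ (π ⟨$⟩ˡ_)) x)) (Vec.[]=⇒lookup x∈))

image-pair : ∀ {n} (π : Permutation n n) x y → image π (pair x y) ≡ pair (π ⟨$⟩ʳ x) (π ⟨$⟩ʳ y)
image-pair π x y = pair-≡
  (∈-image⁺ π (subst (_∈ pair x y) (sym (Perm.inverseˡ π)) ∈-pairˡ))
  (∈-image⁺ π (subst (_∈ pair x y) (sym (Perm.inverseˡ π)) ∈-pairʳ))
  (λ z∈ → Sum.map (λ e → trans (sym (Perm.inverseʳ π)) (cong (π ⟨$⟩ʳ_) e))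
                  (λ e → trans (sym (Perm.inverseʳ π)) (cong (π ⟨$⟩ʳ_) e)) (∈-pair⁻ (∈-image⁻ π z∈)))

transpose-view : ∀ {n} (i j k : Fin n) → let τ = PC.transpose i j in
  (k ≡ i × τ k ≡ j) ⊎ (k ≡ j × τ k ≡ i) ⊎ (k ≢ i × k ≢ j × τ k ≡ k)
transpose-view i j k with k Fin.≟ i
... | yes k≡i = inj₁ (k≡i , refl)
... | no k≢i with k Fin.≟ j
...   | yes k≡j = inj₂ (inj₁ (k≡j , refl))
...   | no k≢j  = inj₂ (inj₂ (k≢i , k≢j , refl))

transposeˡ : ∀ {n} (i j : Fin n) → PC.transpose i j i ≡ j
transposeˡ i j with transpose-view i j i
... | inj₁ (_ , e)               = e
... | inj₂ (inj₁ (i≡j , e))      = trans e i≡j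
... | inj₂ (inj₂ (i≢i , _))      = contradiction refl i≢i

transposeʳ : ∀ {n} (i j : Fin n) → PC.transpose i j j ≡ i
transposeʳ i j with transpose-view i j j
... | inj₁ (j≡i , e)             = trans e j≡i
... | inj₂ (inj₁ (_ , e))        = e
... | inj₂ (inj₂ (_ , j≢j , _))  = contradiction refl j≢j

transpose-≢ : ∀ {n} {i j k : Fin n} → k ≢ i → k ≢ j → PC.transpose i j k ≡ k
transpose-≢ {i = i} {j} {k} k≢i k≢j with transpose-view i j k
... | inj₁ (k≡i , _)             = contradiction k≡i k≢i
... | inj₂ (inj₁ (k≡j , _))      = contradiction k≡j k≢j
... | inj₂ (inj₂ (_ , _ , e))    = e

μ≥1⇒∈ : ∀ {v k} {bs : List (KSubset v k)} {B} → 1 ≤ μ bs B → B ∈ₗ bs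
μ≥1⇒∈ {bs = bs} {B} h with filter (_≟ B) bs in eq
... | C ∷ _ with ∈-filter⁻ (_≟ B) {xs = bs} (subst (C ∈ₗ_) (sym eq) (here refl))
...   | C∈ , refl = C∈

∈⇒μ≥1 : ∀ {v k} {bs : List (KSubset v k)} {B} → B ∈ₗ bs → 1 ≤ μ bs B
∈⇒μ≥1 {B = B} B∈ = ∈-length (∈-filter⁺ (_≟ B) B∈ refl)

-- Graphs as sets of edges

Edges : ℕ → Set
Edges n = Subset (n C 2)

module _ {n : ℕ} where

  ends : Fin (n C 2) → Subset n
  ends i = proj₁ (Inverse.from (KSubset↔Fin n 2) i)

  ends-injective : ∀ {i j} → ends i ≡ ends j → i ≡ j
  ends-injective {i} {j} e = begin
    i                                  ≡⟨ Inverse.strictlyInverseˡ (KSubset↔Fin n 2) i ⟨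
    Inverse.to (KSubset↔Fin n 2) (Inverse.from (KSubset↔Fin n 2) i)
                                       ≡⟨ cong (Inverse.to (KSubset↔Fin n 2)) (KSubset-≡ e) ⟩
    Inverse.to (KSubset↔Fin n 2) (Inverse.from (KSubset↔Fin n 2) j)
                                       ≡⟨ Inverse.strictlyInverseˡ (KSubset↔Fin n 2) j ⟩
    j                                  ∎
    where open ≡-Reasoning

  edge : ∀ {x y} → x ≢ y → ∃ λ i → ends i ≡ pair x y
  edge {x} {y} x≢y = Inverse.to (KSubset↔Fin n 2) (pair x y , ∣pair∣ x≢y) ,
    cong proj₁ (Inverse.strictlyInverseʳ (KSubset↔Fin n 2) (pair x y , ∣pair∣ x≢y))

  ends-pair : ∀ i → ∃₂ λ x y → x ≢ y × ends i ≡ pair x y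
  ends-pair i = ∣p∣≡2⇒pair (ends i) (proj₂ (Inverse.from (KSubset↔Fin n 2) i))

  ends-≢ : ∀ {i x y} → ends i ≡ pair x y → x ≢ y
  ends-≢ {i} {x} e refl with ends-pair i
  ... | u , w , u≢w , e′ = u≢w (trans (only u (subst (u ∈_) (sym e′) ∈-pairˡ)) (sym (only w (subst (w ∈_) (sym e′) ∈-pairʳ))))
    where
    only : ∀ z → z ∈ ends i → z ≡ x
    only z z∈ = [ id , id ]′ (∈-pair⁻ (subst (z ∈_) e z∈))

  ends-onEdges : ∀ (σ : Permutation n n) i → ends (onEdges σ ⟨$⟩ˡ i) ≡ image (Perm.flip σ) (ends i)
  ends-onEdges σ i = cong proj₁ (Inverse.strictlyInverseʳ (KSubset↔Fin n 2)
    (Inverse.from (act σ) (Inverse.from (KSubset↔Fin n 2) i)))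

  Adj : Edges n → Fin n → Fin n → Set
  Adj B x y = ∃ λ i → ends i ≡ pair x y × i ∈ B

  abstract
    adj? : ∀ B x y → Dec (Adj B x y)
    adj? B x y = Fin.any? λ i → Vec.≡-dec Bool._≟_ (ends i) (pair x y) ×-dec (i ∈? B)

  module _ {B : Edges n} where

    adj-sym : ∀ {x y} → Adj B x y → Adj B y x
    adj-sym (i , e , i∈B) = i , trans e (pair-comm _ _) , i∈B

    adj-≢ : ∀ {x y} → Adj B x y → x ≢ y
    adj-≢ (i , e , _) = ends-≢ e

    adj⇒∈ : ∀ {x y i} → ends i ≡ pair x y → Adj B x y → i ∈ B
    adj⇒∈ e (j , e′ , j∈B) = subst (_∈ B) (ends-injective (trans e′ (sym e))) j∈B

    adj-onEdges⁺ : ∀ (σ : Permutation n n) {x y} → Adj B (σ ⟨$⟩ˡ x) (σ ⟨$⟩ˡ y) → Adj (image (onEdges σ) B) x y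
    adj-onEdges⁺ σ {x} {y} a with edge {x} {y} (λ { refl → adj-≢ a refl })
    ... | i , e = i , e , ∈-image⁺ (onEdges σ) (adj⇒∈
      (trans (ends-onEdges σ i) (trans (cong (image (Perm.flip σ)) e) (image-pair (Perm.flip σ) x y))) a)

    adj-onEdges⁻ : ∀ (σ : Permutation n n) {x y} → Adj (image (onEdges σ) B) x y → Adj B (σ ⟨$⟩ˡ x) (σ ⟨$⟩ˡ y)
    adj-onEdges⁻ σ {x} {y} (i , e , i∈) = onEdges σ ⟨$⟩ˡ i ,
      trans (ends-onEdges σ i) (trans (cong (image (Perm.flip σ)) e) (image-pair (Perm.flip σ) x y)) ,
      ∈-image⁻ (onEdges σ) i∈

  -- The transposition of x and y is an automorphism of B.
  Twin : Edges n → Fin n → Fin n → Set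
  Twin B x y = ∀ w → w ≢ x → w ≢ y → (Adj B x w → Adj B y w) × (Adj B y w → Adj B x w)

  abstract
    twin? : ∀ B x y → Dec (Twin B x y)
    twin? B x y = Fin.all? λ w → ¬? (w Fin.≟ x) →-dec ¬? (w Fin.≟ y) →-dec
      (adj? B x w →-dec adj? B y w) ×-dec (adj? B y w →-dec adj? B x w)

  module _ {B : Edges n} where

    twin-refl : ∀ {x} → Twin B x x
    twin-refl _ _ _ = id , id

    twin-sym : ∀ {x y} → Twin B x y → Twin B y x
    twin-sym t w w≢y w≢x = swap (t w w≢x w≢y)

    -- Away from y the two equivalences compose. At w = y the chain passes through the third side of
    -- the triangle: xy corresponds to xz because y and z are twins, and xz to yz because x and y
    -- are.
    twin-trans : ∀ {x y z} → Twin B x y → Twin B y z → Twin B x z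
    twin-trans {x} {y} {z} xy yz w w≢x w≢z with x Fin.≟ y | y Fin.≟ z
    ... | yes refl | _        = yz w w≢x w≢z
    ... | no _     | yes refl = xy w w≢x w≢z
    ... | no x≢y   | no y≢z with w Fin.≟ y | x Fin.≟ z
    ...   | no w≢y   | _        = proj₁ (yz w w≢y w≢z) ∘ proj₁ (xy w w≢x w≢y) ,
                                  proj₂ (xy w w≢x w≢y) ∘ proj₂ (yz w w≢y w≢z)
    ...   | yes refl | yes refl = id , id
    ...   | yes refl | no x≢z   =
      adj-sym ∘ proj₁ (xy z (≢-sym x≢z) (≢-sym y≢z)) ∘ adj-sym ∘ proj₁ (yz x x≢y x≢z) ∘ adj-sym ,
      adj-sym ∘ proj₂ (yz x x≢y x≢z) ∘ adj-sym ∘ proj₂ (xy z (≢-sym x≢z) (≢-sym y≢z)) ∘ adj-sym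

    twin⇒adj-transpose : ∀ {x y} → Twin B x y → ∀ {u w} → Adj B u w →
                         Adj B (PC.transpose x y u) (PC.transpose x y w)
    twin⇒adj-transpose {x} {y} xy {u} {w} a with transpose-view x y u | transpose-view x y w
    ... | inj₁ (refl , e) | inj₁ (refl , e′) = contradiction refl (adj-≢ a)
    ... | inj₁ (refl , e) | inj₂ (inj₁ (refl , e′)) = subst₂ (Adj B) (sym e) (sym e′) (adj-sym a)
    ... | inj₁ (refl , e) | inj₂ (inj₂ (w≢x , w≢y , e′)) = subst₂ (Adj B) (sym e) (sym e′) (proj₁ (xy w w≢x w≢y) a)
    ... | inj₂ (inj₁ (refl , e)) | inj₁ (refl , e′) = subst₂ (Adj B) (sym e) (sym e′) (adj-sym a)
    ... | inj₂ (inj₁ (refl , e)) | inj₂ (inj₁ (refl , e′)) = contradiction refl (adj-≢ a)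
    ... | inj₂ (inj₁ (refl , e)) | inj₂ (inj₂ (w≢x , w≢y , e′)) = subst₂ (Adj B) (sym e) (sym e′) (proj₂ (xy w w≢x w≢y) a)
    ... | inj₂ (inj₂ (u≢x , u≢y , e)) | inj₁ (refl , e′) =
      subst₂ (Adj B) (sym e) (sym e′) (adj-sym (proj₁ (xy u u≢x u≢y) (adj-sym a)))
    ... | inj₂ (inj₂ (u≢x , u≢y , e)) | inj₂ (inj₁ (refl , e′)) =
      subst₂ (Adj B) (sym e) (sym e′) (adj-sym (proj₂ (xy u u≢x u≢y) (adj-sym a)))
    ... | inj₂ (inj₂ (_ , _ , e)) | inj₂ (inj₂ (_ , _ , e′)) = subst₂ (Adj B) (sym e) (sym e′) a

    -- If two transpositions at p move B to the same place then B is invariant under a 3-cycle;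
    -- edges being unordered, B is then invariant under the transpositions as well.
    same-image⇒twin : ∀ {x y p} → x ≢ p → y ≢ p → x ≢ y →
      image (onEdges (transpose x p)) B ≡ image (onEdges (transpose y p)) B → Twin B x p
    same-image⇒twin {x} {y} {p} x≢p y≢p x≢y eq w w≢x w≢p = towards , back
      where
      σ = transpose x p
      τ = transpose y p

      σ⇒τ : ∀ u v → Adj B (σ ⟨$⟩ˡ u) (σ ⟨$⟩ˡ v) → Adj B (τ ⟨$⟩ˡ u) (τ ⟨$⟩ˡ v)
      σ⇒τ u v a = adj-onEdges⁻ τ {u} {v} (subst (λ G → Adj G u v) eq (adj-onEdges⁺ σ {u} {v} a))

      τ⇒σ : ∀ u v → Adj B (τ ⟨$⟩ˡ u) (τ ⟨$⟩ˡ v) → Adj B (σ ⟨$⟩ˡ u) (σ ⟨$⟩ˡ v)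
      τ⇒σ u v a = adj-onEdges⁻ σ {u} {v} (subst (λ G → Adj G u v) (sym eq) (adj-onEdges⁺ τ {u} {v} a))

      σx≡p = transposeʳ p x
      σp≡x = transposeˡ p x
      τp≡y = transposeˡ p y
      τy≡p = transposeʳ p y
      σy≡y = transpose-≢ {i = p} {x} y≢p (≢-sym x≢y)
      τx≡x = transpose-≢ {i = p} {y} x≢p x≢y
      σw≡w = transpose-≢ {i = p} {x} w≢p w≢x

      towards : Adj B x w → Adj B p w
      -- The 3-cycle x, y, p fixes every other w, so one application of it or its inverse suffices
      -- there. For w = y the other end moves too: the edge xy goes to yp.
      towards a with w Fin.≟ y
      ... | yes refl = adj-sym (subst₂ (Adj B) τp≡y τy≡p (σ⇒τ p y (subst₂ (Adj B) (sym σp≡x) (sym σy≡y) a)))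
      ... | no w≢y   = subst₂ (Adj B) σx≡p σw≡w
        (τ⇒σ x w (subst₂ (Adj B) (sym τx≡x) (sym (transpose-≢ {i = p} {y} w≢p w≢y)) a))

      back : Adj B p w → Adj B x w
      back a with w Fin.≟ y
      ... | yes refl = subst₂ (Adj B) σp≡x σy≡y (τ⇒σ p y (subst₂ (Adj B) (sym τp≡y) (sym τy≡p) (adj-sym a)))
      ... | no w≢y   = subst₂ (Adj B) τx≡x (transpose-≢ {i = p} {y} w≢p w≢y)
        (σ⇒τ x w (subst₂ (Adj B) (sym σx≡p) (sym σw≡w) a))

  -- The images of B under the transpositions of p with the points of xs are
  -- pairwise distinct blocks containing T.
  twins-in-block : ∀ {t k Λ} (D : Design t (n C 2) k Λ) → Graphical n D →
    (B : KSubset (n C 2) k) → B ∈ₗ blocks D → (T : KSubset (n C 2) t) → proj₁ T ⊆ proj₁ B →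
    ∀ p xs → Unique xs → (∀ {x} → x ∈ₗ xs → Twin (proj₁ T) x p) →
    (∀ {x} → x ∈ₗ xs → ¬ Twin (proj₁ B) x p) → length xs ≤ Λ
  twins-in-block {t} {k} {Λ} D graphical B B∈ T T⊆B p xs u twinT ¬twinB = begin
    length xs                                              ≡⟨ List.length-map moved xs ⟨
    length (map moved xs)                                  ≤⟨ unique-⊆-length (map-unique moved u injective) moved∈ ⟩
    length (filter (λ B → proj₁ T ⊆? proj₁ B) (blocks D))  ≡⟨ Design.balanced D T ⟩
    Λ                                                      ∎
    where
    open ℕ.≤-Reasoning

    moved : Fin n → KSubset (n C 2) k
    moved x = onEdges (transpose x p) · B

    ≢p : ∀ {x} → x ∈ₗ xs → x ≢ p
    ≢p x∈ refl = ¬twinB x∈ twin-refl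

    injective : ∀ {x y} → x ∈ₗ xs → y ∈ₗ xs → moved x ≡ moved y → x ≡ y
    injective {x} {y} x∈ y∈ e = decidable-stable (x Fin.≟ y) λ x≢y →
      ¬twinB x∈ (same-image⇒twin (≢p x∈) (≢p y∈) x≢y (cong proj₁ e))

    T⊆moved : ∀ {x} → x ∈ₗ xs → proj₁ T ⊆ proj₁ (moved x)
    T⊆moved {x} x∈ {i} i∈T =
      let u , w , _ , e   = ends-pair i
          j , e′ , j∈T = twin⇒adj-transpose {B = proj₁ T} (twin-sym {B = proj₁ T} (twinT x∈)) (i , e , i∈T)
      in adj⇒∈ {B = proj₁ (moved x)} e (adj-onEdges⁺ {B = proj₁ B} (transpose x p) {u} {w} (j , e′ , T⊆B j∈T))

    moved∈ : ∀ {C} → C ∈ₗ map moved xs → C ∈ₗ filter (λ B → proj₁ T ⊆? proj₁ B) (blocks D)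
    moved∈ {C} C∈ =
      let x , x∈ , C≡ = ∈-map⁻ moved C∈
      in subst (_∈ₗ filter (λ B → proj₁ T ⊆? proj₁ B) (blocks D)) (sym C≡)
           (∈-filter⁺ (λ B → proj₁ T ⊆? proj₁ B)
             (μ≥1⇒∈ {bs = blocks D} (subst (1 ≤_) (sym (graphical (transpose x p) B)) (∈⇒μ≥1 {bs = blocks D} B∈)))
             (T⊆moved x∈))

-- Counting edges through the list of their pairs of ends.

take-⊆ : ∀ {A : Set} l {xs : List A} {x} → x ∈ₗ take l xs → x ∈ₗ xs
take-⊆ (suc l) {_ ∷ _} (here e)   = here e
take-⊆ (suc l) {_ ∷ _} (there x∈) = there (take-⊆ l x∈)

length-++-≡ : ∀ {A : Set} (xs ys : List A) {k l} → length xs ≡ k → length ys ≡ l → length (xs ++ ys) ≡ k + l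
length-++-≡ xs ys e e′ = trans (List.length-++ xs) (cong₂ _+_ e e′)

module _ {n : ℕ} where

  open DecMembership (Vec.≡-dec {n = n} Bool._≟_) using () renaming (_∈?_ to _∈ₛ?_)

  endsOf : Edges n → List (Subset n)
  endsOf B = map ends (elements B)

  length-endsOf : ∀ B → length (endsOf B) ≡ ∣ B ∣
  length-endsOf B = trans {j = length (elements B)} (List.length-map (ends {n}) (elements B)) (length-elements B)

  endsOf-unique : ∀ B → Unique (endsOf B)
  endsOf-unique B = map-unique ends (elements-unique B) λ _ _ → ends-injective

  ∈-endsOf⁺ : ∀ {B i} → i ∈ B → ends i ∈ₗ endsOf B
  ∈-endsOf⁺ i∈B = ∈-map⁺ ends (∈-elements⁺ i∈B)

  ∈-endsOf⁻ : ∀ {B s} → s ∈ₗ endsOf B → ∃ λ i → i ∈ B × s ≡ ends i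
  ∈-endsOf⁻ s∈ = let i , i∈ , e = ∈-map⁻ ends s∈ in i , ∈-elements⁻ i∈ , e

  adj⇒∈-endsOf : ∀ {B x y} → Adj B x y → pair x y ∈ₗ endsOf B
  adj⇒∈-endsOf {B} (i , e , i∈B) = subst (_∈ₗ endsOf B) e (∈-endsOf⁺ i∈B)

  ∣∣≤length : ∀ {B xs} → (∀ {i} → i ∈ B → ends i ∈ₗ xs) → ∣ B ∣ ≤ length xs
  ∣∣≤length {B} {xs} h = subst (_≤ length xs) (length-endsOf B) (unique-⊆-length (endsOf-unique B) λ s∈ →
    let i , i∈B , e = ∈-endsOf⁻ s∈ in subst (_∈ₗ xs) (sym e) (h i∈B))

  length≤∣∣ : ∀ {B xs} → Unique xs → (∀ {s} → s ∈ₗ xs → s ∈ₗ endsOf B) → length xs ≤ ∣ B ∣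
  length≤∣∣ {B} {xs} u h = subst (length xs ≤_) (length-endsOf B) (unique-⊆-length u h)

  -- Edges inside a set of vertices

  Inner : List (Fin n) → Fin (n C 2) → Set
  Inner Vs i = ends i ∈ₗ cartesianProductWith pair Vs Vs

  inner? : ∀ Vs → Decidable (Inner Vs)
  inner? Vs i = ends i ∈ₛ? cartesianProductWith pair Vs Vs

  inner : List (Fin n) → Edges n
  inner Vs = subset (inner? Vs)

  outer : List (Fin n) → Edges n
  outer Vs = ∁ (inner Vs)

  inner⁺ : ∀ {Vs x y i} → x ∈ₗ Vs → y ∈ₗ Vs → ends i ≡ pair x y → i ∈ inner Vs
  inner⁺ {Vs} x∈ y∈ e = ∈-subset⁺ (inner? Vs)
    (subst (_∈ₗ cartesianProductWith pair Vs Vs) (sym e) (∈-cartesianProductWith⁺ pair x∈ y∈))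

  inner⁻ : ∀ {Vs i} → i ∈ inner Vs → ∃₂ λ x y → x ∈ₗ Vs × y ∈ₗ Vs × ends i ≡ pair x y
  inner⁻ {Vs} i∈ = ∈-cartesianProductWith⁻ pair Vs Vs (∈-subset⁻ (inner? Vs) i∈)

  inner-ends : ∀ {Vs i x y} → i ∈ inner Vs → ends i ≡ pair x y → x ∈ₗ Vs × y ∈ₗ Vs
  inner-ends {Vs} {i} i∈ e =
    let u , w , u∈ , w∈ , e′ = inner⁻ {Vs} i∈
    in [ (λ { (refl , refl) → u∈ , w∈ }) , (λ { (refl , refl) → w∈ , u∈ }) ]′
         (pair-injective (ends-≢ {n} {i} e) (trans (sym e) e′))

  inner-other : ∀ {Vs i x} → i ∈ inner Vs → x ∈ ends {n} i → ∃ λ y → y ∈ₗ Vs × ends i ≡ pair x y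
  inner-other {Vs} {i} {x} i∈ x∈ =
    let u , w , u∈ , w∈ , e = inner⁻ {Vs} i∈
    in [ (λ { refl → w , w∈ , e }) , (λ { refl → u , u∈ , trans e (pair-comm u w) }) ]′
         (∈-pair⁻ (subst (x ∈_) e x∈))

  ∣inner∣≤ : ∀ Vs → ∣ inner Vs ∣ ≤ length Vs * length Vs
  ∣inner∣≤ Vs = ℕ.≤-trans (∣∣≤length {inner Vs} {cartesianProductWith pair Vs Vs} (∈-subset⁻ (inner? Vs)))
    (ℕ.≤-reflexive (length-cartesianProductWith pair Vs Vs))

  ∣inner-∷∣≤ : ∀ x Vs → ∣ inner (x ∷ Vs) ∣ ≤ ∣ inner Vs ∣ + length Vs
  ∣inner-∷∣≤ x Vs = ℕ.≤-trans (∣∣≤length {inner (x ∷ Vs)} {endsOf (inner Vs) ++ map (pair x) Vs} covered)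
    (ℕ.≤-reflexive (length-++-≡ (endsOf (inner Vs)) (map (pair x) Vs)
      (length-endsOf (inner Vs)) (List.length-map (pair x) Vs)))
    where
    at-x : ∀ {i y} → y ∈ₗ Vs → ends i ≡ pair x y → ends i ∈ₗ endsOf (inner Vs) ++ map (pair x) Vs
    at-x {i} y∈ e = ∈-++⁺ʳ (endsOf (inner Vs)) (subst (_∈ₗ map (pair x) Vs) (sym e) (∈-map⁺ (pair x) y∈))

    covered : ∀ {i} → i ∈ inner (x ∷ Vs) → ends i ∈ₗ endsOf (inner Vs) ++ map (pair x) Vs
    covered {i} i∈ with inner⁻ {x ∷ Vs} i∈
    ... | u , w , here refl , here refl , e = contradiction refl (ends-≢ {n} {i} e)
    ... | u , w , here refl , there w∈  , e = at-x w∈ e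
    ... | u , w , there u∈  , here refl , e = at-x u∈ (trans e (pair-comm u w))
    ... | u , w , there u∈  , there w∈  , e = ∈-++⁺ˡ (∈-endsOf⁺ {inner Vs} (inner⁺ u∈ w∈ e))

  ∣inner-all∣ : ∣ inner (allFin n) ∣ ≡ n C 2
  ∣inner-all∣ = trans (cong ∣_∣ (⊆-antisym {i = inner (allFin n)} {j = Subset.⊤} ⊆⊤ λ {i} _ →
    let x , y , _ , e = ends-pair i in inner⁺ (∈-allFin x) (∈-allFin y) e)) (∣⊤∣≡n (n C 2))

  ∣outer∣ : ∀ Vs → ∣ outer Vs ∣ + ∣ inner Vs ∣ ≡ n C 2
  ∣outer∣ Vs = trans (cong (_+ ∣ inner Vs ∣) (∣∁p∣≡n∸∣p∣ (inner Vs))) (ℕ.m∸n+n≡m (∣p∣≤n (inner Vs)))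

  inner⊎outer : ∀ Vs i → i ∈ inner Vs ⊎ i ∈ outer Vs
  inner⊎outer Vs i with i ∈? inner Vs
  ... | yes i∈ = inj₁ i∈
  ... | no i∉  = inj₂ (x∉p⇒x∈∁p i∉)

  Avoids : List (Fin n) → Edges n → Fin n → Set
  Avoids Vs T x = ∀ i → i ∈ T → i ∈ inner Vs → x ∉ ends i

  -- Both vertices are joined in T to everything outside `Vs`, since T contains the outer edges, and
  -- to nothing inside `Vs`.
  avoiding⇒twin : ∀ Vs T {x y} → outer Vs ⊆ T → x ∈ₗ Vs → y ∈ₗ Vs → Avoids Vs T x → Avoids Vs T y → Twin T x y
  avoiding⇒twin Vs T {x} {y} outer⊆T x∈ y∈ avoids-x avoids-y w w≢x w≢y =
    move x∈ (≢-sym w≢y) avoids-x , move y∈ (≢-sym w≢x) avoids-y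
    where
    move : ∀ {a b} → a ∈ₗ Vs → b ≢ w → Avoids Vs T a → Adj T a w → Adj T b w
    move {a} {b} a∈ b≢w avoids (i , e , i∈T) with edge b≢w
    ... | j , e′ with inner⊎outer Vs j
    ...   | inj₁ j∈ = contradiction (subst (a ∈_) (sym e) ∈-pairˡ)
                        (avoids i i∈T (inner⁺ a∈ (proj₂ (inner-ends {Vs} j∈ e′)) e))
    ...   | inj₂ j∈ = j , e′ , outer⊆T j∈

  -- q has degree 1, with neighbour q′, in the part of T inside Vs.
  Leaf : List (Fin n) → Edges n → Fin n → Fin n → Set
  Leaf Vs T q q′ = q ∈ₗ Vs × q′ ∈ₗ Vs × Adj T q q′ × (∀ {i} → i ∈ T → i ∈ inner Vs → q ∈ ends i → ends i ≡ pair q q′)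

  -- The form in which balance and symmetry enter the analysis of a single block; `twins-in-block`
  -- supplies it. It ranges over all t-sets in B because it is applied to T₀ and also to t-sets that
  -- avoid chosen vertices inside `Vs`.
  FewNontwins : ℕ → ℕ → Edges n → Set
  FewNontwins t Λ B = ∀ (T : Edges n) → ∣ T ∣ ≡ t → T ⊆ B → ∀ (x : Fin n) (xs : List (Fin n)) → Unique xs →
    (∀ {y} → y ∈ₗ xs → Twin T y x) → (∀ {y} → y ∈ₗ xs → ¬ Twin B y x) → length xs ≤ Λ

-- Degrees inside a single block that contains T₀.

module Block {n t Λ : ℕ} (B T₀ : Edges n) (few : FewNontwins {n} t Λ B)
  (Vs : List (Fin n)) (Vs-unique : Unique Vs)
  (outer⊆T₀ : outer {n} Vs ⊆ T₀) (T₀⊆B : T₀ ⊆ B) (∣T₀∣≡t : ∣ T₀ ∣ ≡ t)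
  (t<∣B∣ : t < ∣ B ∣) (∣B∣<v : ∣ B ∣ < n C 2)
  (p : Fin n) (R : List (Fin n)) (pR-unique : Unique (p ∷ R))
  (pR⊆Vs : ∀ {z} → z ∈ₗ p ∷ R → z ∈ₗ Vs) (pR-isolated : ∀ {z} → z ∈ₗ p ∷ R → Avoids {n} Vs T₀ z)
  (q₁ q₂ q₃ q₄ : Fin n)
  (leaf₁ : Leaf {n} Vs T₀ q₁ q₂) (leaf₂ : Leaf {n} Vs T₀ q₂ q₁) (leaf₃ : Leaf {n} Vs T₀ q₃ q₄)
  (q₁≢q₃ : q₁ ≢ q₃) (q₁≢q₄ : q₁ ≢ q₄) (q₂≢q₃ : q₂ ≢ q₃) (q₂≢q₄ : q₂ ≢ q₄) (q₂≢p : q₂ ≢ p)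
  where

  open DecMembership (Fin._≟_ {n}) using () renaming (_∈?_ to _∈ₗ?_)

  private
    o = outer Vs

  m : ℕ
  m = length Vs

  -- Only neighbours inside `Vs` are listed; the length is the degree deg x of the overview.
  N : Fin n → List (Fin n)
  N x = filter (adj? B x) Vs

  N-unique : ∀ x → Unique (N x)
  N-unique x = Unique.filter⁺ (adj? B x) Vs-unique

  ∈-N⁻ : ∀ {x y} → y ∈ₗ N x → y ∈ₗ Vs × Adj B x y
  ∈-N⁻ {x} = ∈-filter⁻ (adj? B x) {xs = Vs}

  ∣N∣≤m : ∀ x → length (N x) ≤ m
  ∣N∣≤m x = List.length-filter (adj? B x) Vs

  -- The transposition of x and p carries the edge xy to py, except when y = p, where x itself is a
  -- neighbour of p.
  twin⇒N : ∀ {x y} → x ∈ₗ Vs → y ∈ₗ Vs → Twin B x p → Adj B x y → x ∈ₗ N p ⊎ y ∈ₗ N p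
  twin⇒N {x} {y} x∈ y∈ x~p a with y Fin.≟ p
  ... | yes refl = inj₁ (∈-filter⁺ (adj? B p) x∈ (adj-sym {B = B} a))
  ... | no y≢p   = inj₂ (∈-filter⁺ (adj? B p) y∈ (proj₁ (x~p y (≢-sym (adj-≢ {B = B} a)) y≢p) a))

  Z₀ : List (Fin n)
  Z₀ = p ∷ filter (λ z → twin? B z p) R

  Z₀-unique : Unique Z₀
  Z₀-unique =
    All.tabulate (λ z∈ → All.lookup (AllPairs.head pR-unique) (proj₁ (∈-filter⁻ (λ z → twin? B z p) {xs = R} z∈)))
    ∷ Unique.filter⁺ (λ z → twin? B z p) (AllPairs.tail pR-unique)

  Z₀⊆pR : ∀ {z} → z ∈ₗ Z₀ → z ∈ₗ p ∷ R
  Z₀⊆pR (here e)   = here e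
  Z₀⊆pR (there z∈) = there (proj₁ (∈-filter⁻ (λ z → twin? B z p) {xs = R} z∈))

  Z₀-twin : ∀ {z} → z ∈ₗ Z₀ → Twin B z p
  Z₀-twin (here refl) = twin-refl {B = B}
  Z₀-twin (there z∈)  = proj₂ (∈-filter⁻ (λ z → twin? B z p) {xs = R} z∈)

  -- All of `R` are twins of p in T₀, being isolated there inside `Vs`; by `few` at most Λ of them
  -- are no longer twins of p in B.
  ∣R∣≤ : suc (length R) ≤ length Z₀ + Λ
  ∣R∣≤ = s≤s (begin
    length R                                          ≡⟨ length-filter-∁ ~p? ≁p? R ⟩
    length (filter ~p? R) + length (filter ≁p? R)     ≤⟨ ℕ.+-monoʳ-≤ (length (filter ~p? R)) few-nontwins ⟩
    length (filter ~p? R) + Λ                         ∎)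
    where
    open ℕ.≤-Reasoning
    ~p? : Decidable (λ z → Twin B z p)
    ~p? z = twin? B z p
    ≁p? : Decidable (λ z → ¬ Twin B z p)
    ≁p? z = ¬? (twin? B z p)
    in-R : ∀ {y} → y ∈ₗ filter ≁p? R → y ∈ₗ R
    in-R y∈ = proj₁ (∈-filter⁻ ≁p? {xs = R} y∈)
    few-nontwins : length (filter ≁p? R) ≤ Λ
    few-nontwins = few T₀ ∣T₀∣≡t T₀⊆B p (filter ≁p? R) (Unique.filter⁺ ≁p? (AllPairs.tail pR-unique))
      (λ y∈ → avoiding⇒twin Vs T₀ outer⊆T₀ (pR⊆Vs (there (in-R y∈))) (pR⊆Vs (here refl))
                (pR-isolated (there (in-R y∈))) (pR-isolated (here refl)))
      (λ y∈ → proj₂ (∈-filter⁻ ≁p? {xs = R} y∈))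

  -- Λ + 1 twins of p, one more than `few` tolerates, once `Z₀` is known to be long enough.
  Z : List (Fin n)
  Z = take (suc Λ) Z₀

  Z⊆Z₀ : ∀ {z} → z ∈ₗ Z → z ∈ₗ Z₀
  Z⊆Z₀ = take-⊆ (suc Λ)

  Kept : Fin n → Fin (n C 2) → Set
  Kept x i = i ∈ B × (i ∈ o ⊎ All (_∉ ends i) (x ∷ Z))

  kept? : ∀ x → Decidable (Kept x)
  kept? x i = (i ∈? B) ×-dec ((i ∈? o) ⊎-dec All.all? (λ z → ¬? (z ∈? ends i)) (x ∷ Z))

  kept : Fin n → Edges n
  kept x = subset (kept? x)

  module _ (Λ<∣Z₀∣ : Λ < length Z₀) where

    ∣Z∣ : length Z ≡ suc Λ
    ∣Z∣ = trans (List.length-take (suc Λ) Z₀) (ℕ.m≤n⇒m⊓n≡m Λ<∣Z₀∣)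

    -- Otherwise a t-set between o and kept x would be invariant under all
    -- transpositions of x with the points of Z, but B is invariant under none.
    ∣kept∣<t : ∀ {x} → x ∈ₗ Vs → ¬ Twin B x p → ∣ kept x ∣ < t
    ∣kept∣<t {x} x∈ x≁p = ℕ.≰⇒> λ t≤ →
      let T , o⊆T , T⊆kept , ∣T∣≡t = interpolate o (kept x) o⊆kept (ℕ.≤-trans (p⊆q⇒∣p∣≤∣q∣ outer⊆T₀) (ℕ.≤-reflexive ∣T₀∣≡t)) t≤
          avoids : ∀ {y} → y ∈ₗ x ∷ Z → Avoids Vs T y
          avoids y∈ i i∈T i∈inner = [ (λ i∈o → contradiction i∈inner (x∈∁p⇒x∉p i∈o)) , (λ all → All.lookup all y∈) ]′
            (proj₂ (∈-subset⁻ (kept? x) (T⊆kept i∈T)))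
      in ℕ.<⇒≱ (ℕ.≤-reflexive (sym ∣Z∣))
           (few T ∣T∣≡t (λ i∈T → proj₁ (∈-subset⁻ (kept? x) (T⊆kept i∈T))) x Z (Unique.take⁺ (suc Λ) Z₀-unique)
             (λ z∈ → avoiding⇒twin Vs T o⊆T (pR⊆Vs (Z₀⊆pR (Z⊆Z₀ z∈))) x∈ (avoids (there z∈)) (avoids (here refl)))
             (λ z∈ z~x → x≁p (twin-trans {B = B} (twin-sym {B = B} z~x) (Z₀-twin (Z⊆Z₀ z∈)))))
      where
      o⊆kept : o ⊆ kept x
      o⊆kept i∈o = ∈-subset⁺ (kept? x) (T₀⊆B (outer⊆T₀ i∈o) , inj₁ i∈o)

    -- Passing from B to `kept x` deletes only inner edges at x and at the Λ + 1 vertices of `Z`.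
    -- The former number at most deg x; the latter at most deg p for each vertex of `Z`, as these
    -- are twins of p. Fewer than t edges remain.
    ∣B∣<cost : ∀ {x} → x ∈ₗ Vs → ¬ Twin B x p → ∣ B ∣ < t + (length (N x) + suc Λ * length (N p))
    ∣B∣<cost {x} x∈ x≁p = begin-strict
      ∣ B ∣                                                                     ≤⟨ ∣∣≤length {B = B} {xs = removed} covered ⟩
      length removed                                                            ≡⟨ lengths ⟩
      ∣ kept x ∣ + (length (N x) + length Z * length (N p))                     <⟨ ℕ.+-monoˡ-< _ (∣kept∣<t x∈ x≁p) ⟩
      t + (length (N x) + length Z * length (N p))                              ≡⟨ cong (λ l → t + (length (N x) + l * length (N p))) ∣Z∣ ⟩
      t + (length (N x) + suc Λ * length (N p))                                 ∎
      where
      open ℕ.≤-Reasoning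
      at-x = map (pair x) (N x)
      at-Z = cartesianProductWith pair Z (N p)
      removed = endsOf (kept x) ++ at-x ++ at-Z

      lengths : length removed ≡ ∣ kept x ∣ + (length (N x) + length Z * length (N p))
      lengths = length-++-≡ (endsOf (kept x)) (at-x ++ at-Z) (length-endsOf {n} (kept x))
        (length-++-≡ at-x at-Z (List.length-map (pair x) (N x)) (length-cartesianProductWith pair Z (N p)))

      neighbour : ∀ {z w i} → z ∈ₗ Z → w ∈ₗ Vs → ends i ≡ pair z w → Adj B z w → Dec (w ≡ p) → ends i ∈ₗ at-Z
      -- Here w = p need not be a neighbour of p, so the edge zp is found in the list as p, the
      -- first element of `Z`, joined to its neighbour z.
      neighbour {z} {w} z∈ w∈ e a (yes refl) = subst (_∈ₗ at-Z) (trans (pair-comm p z) (sym e))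
        (∈-cartesianProductWith⁺ pair {xs = Z} (here refl)
          (∈-filter⁺ (adj? B p) (pR⊆Vs (Z₀⊆pR (Z⊆Z₀ z∈))) (adj-sym {B = B} a)))
      neighbour {z} {w} z∈ w∈ e a (no w≢p)   = subst (_∈ₗ at-Z) (sym e) (∈-cartesianProductWith⁺ pair z∈
        (∈-filter⁺ (adj? B p) w∈ (proj₁ (Z₀-twin (Z⊆Z₀ z∈) w (≢-sym (adj-≢ {B = B} a)) w≢p) a)))

      touching : ∀ {i y} → i ∈ B → i ∈ inner Vs → y ∈ₗ x ∷ Z → y ∈ ends i → ends i ∈ₗ at-x ++ at-Z
      touching {i} i∈B i∈inner (here refl) y∈e =
        let w , w∈ , e = inner-other {Vs = Vs} i∈inner y∈e
        in ∈-++⁺ˡ (subst (_∈ₗ at-x) (sym e) (∈-map⁺ (pair x) (∈-filter⁺ (adj? B x) w∈ (i , e , i∈B))))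
      touching {i} i∈B i∈inner (there z∈) z∈e =
        let w , w∈ , e = inner-other {Vs = Vs} i∈inner z∈e
        in ∈-++⁺ʳ at-x (neighbour z∈ w∈ e (i , e , i∈B) (w Fin.≟ p))

      by-touching : ∀ {i} → i ∈ B → i ∈ inner Vs → Dec (All (_∉ ends i) (x ∷ Z)) → ends i ∈ₗ removed
      by-touching     i∈B _       (yes all) = ∈-++⁺ˡ (∈-endsOf⁺ {B = kept x} (∈-subset⁺ (kept? x) (i∈B , inj₂ all)))
      by-touching {i} i∈B i∈inner (no ¬all) =
        let y , y∈ , ¬y∉ = find (All.¬All⇒Any¬ (λ z → ¬? (z ∈? ends i)) (x ∷ Z) ¬all)
        in ∈-++⁺ʳ (endsOf (kept x)) (touching i∈B i∈inner y∈ (decidable-stable (y ∈? ends i) ¬y∉))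

      covered : ∀ {i} → i ∈ B → ends i ∈ₗ removed
      covered {i} i∈B = [ (λ i∈inner → by-touching i∈B i∈inner (All.all? (λ z → ¬? (z ∈? ends i)) (x ∷ Z)))
                        , (λ i∈o → ∈-++⁺ˡ (∈-endsOf⁺ {B = kept x} (∈-subset⁺ (kept? x) (i∈B , inj₁ i∈o)))) ]′
                        (inner⊎outer Vs i)

    -- Twins of p inherit its neighbours, so all edges between `Y` and `A` lie in B. Disjointness
    -- makes these pairs distinct, and none is in T₀, where the vertices of `Y` are isolated inside
    -- `Vs`.
    t+product≤∣B∣ : ∀ Y A → Unique Y → Unique A → (∀ {y} → y ∈ₗ Y → y ∈ₗ Z₀) → (∀ {a} → a ∈ₗ A → a ∈ₗ N p) →
                    (∀ {y} → y ∈ₗ Y → y ∉ₗ A) → t + length Y * length A ≤ ∣ B ∣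
    t+product≤∣B∣ Y A uY uA Y⊆ A⊆ Y∩A = begin
      t + length Y * length A        ≡⟨ length-++-≡ (endsOf T₀) YA (trans (length-endsOf {n} T₀) ∣T₀∣≡t)
                                          (length-cartesianProductWith pair Y A) ⟨
      length (endsOf T₀ ++ YA)       ≤⟨ length≤∣∣ {B = B} {xs = endsOf T₀ ++ YA}
                                          (Unique.++⁺ (endsOf-unique T₀) YA-unique λ (s∈ , s∈′) → disjoint s∈ s∈′)
                                          (λ s∈ → [ in-T₀ , in-YA ]′ (∈-++⁻ (endsOf T₀) s∈)) ⟩
      ∣ B ∣                          ∎
      where
      open ℕ.≤-Reasoning
      YA = cartesianProductWith pair Y A

      YA-unique : Unique YA
      YA-unique = cartesianProductWith-unique pair uY uA λ {y} {a} {y′} {a′} y∈ a∈ y′∈ a′∈ e →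
        [ id , (λ (y≡a′ , _) → contradiction (subst (_∈ₗ A) (sym y≡a′) a′∈) (Y∩A y∈)) ]′
          (pair-injective (λ y≡a → Y∩A y∈ (subst (_∈ₗ A) (sym y≡a) a∈)) e)

      in-T₀ : ∀ {s} → s ∈ₗ endsOf T₀ → s ∈ₗ endsOf B
      in-T₀ s∈ = let i , i∈ , e = ∈-endsOf⁻ {B = T₀} s∈ in subst (_∈ₗ endsOf B) (sym e) (∈-endsOf⁺ {B = B} (T₀⊆B i∈))

      in-YA : ∀ {s} → s ∈ₗ YA → s ∈ₗ endsOf B
      in-YA s∈ =
        let y , a , y∈ , a∈ , e = ∈-cartesianProductWith⁻ pair Y A s∈
            _ , p-a = ∈-N⁻ {p} (A⊆ a∈)
        in subst (_∈ₗ endsOf B) (sym e) (adj⇒∈-endsOf {B = B}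
             (proj₂ (Z₀-twin (Y⊆ y∈) a (λ a≡y → Y∩A y∈ (subst (_∈ₗ A) a≡y a∈)) (≢-sym (adj-≢ {B = B} p-a))) p-a))

      disjoint : ∀ {s} → s ∈ₗ endsOf T₀ → ¬ s ∈ₗ YA
      disjoint s∈ s∈′ =
        let i , i∈ , e = ∈-endsOf⁻ {B = T₀} s∈
            y , a , y∈ , a∈ , e′ = ∈-cartesianProductWith⁻ pair Y A s∈′
            e″ = trans (sym e) e′
            y∈pR = Z₀⊆pR (Y⊆ y∈)
        in pR-isolated y∈pR i i∈ (inner⁺ (pR⊆Vs y∈pR) (proj₁ (∈-N⁻ {p} (A⊆ a∈))) e″) (subst (y ∈_) (sym e″) ∈-pairˡ)

    private
      Leaf⇒adj : ∀ {q q′} → Leaf Vs T₀ q q′ → Adj B q q′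
      Leaf⇒adj (_ , _ , (i , e , i∈T₀) , _) = i , e , T₀⊆B i∈T₀

    -- Otherwise B would be invariant under all permutations of `Vs`. The edge q₁q₂ then spreads to
    -- every pair inside `Vs`, and with the outer edges B would be the whole point set, against k <
    -- v.
    ¬all-twins : ¬ All (λ x → Twin B x p) Vs
    ¬all-twins all = ℕ.<⇒≱ ∣B∣<v (subst (_≤ ∣ B ∣) (∣⊤∣≡n (n C 2)) (p⊆q⇒∣p∣≤∣q∣ {p = Subset.⊤} {q = B} λ {i} _ → everything i))
      where
      twin : ∀ {x} → x ∈ₗ Vs → Twin B x p
      twin = All.lookup all

      q₁∈ = proj₁ leaf₁
      q₂∈ = proj₁ leaf₂

      p-q₂ : Adj B p q₂
      p-q₂ = proj₁ (twin q₁∈ q₂ (≢-sym (adj-≢ {B = B} (Leaf⇒adj leaf₁))) q₂≢p) (Leaf⇒adj leaf₁)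

      p-any : ∀ {y} → y ∈ₗ Vs → y ≢ p → Dec (y ≡ q₂) → Adj B p y
      p-any y∈ y≢p (yes refl) = p-q₂
      p-any {y} y∈ y≢p (no y≢q₂) = proj₁ (twin q₂∈ y y≢q₂ y≢p)
        (adj-sym {B = B} (proj₂ (twin y∈ q₂ (≢-sym y≢q₂) q₂≢p) p-q₂))

      any-any : ∀ {u w} → u ∈ₗ Vs → w ∈ₗ Vs → u ≢ w → Dec (u ≡ p) → Dec (w ≡ p) → Adj B u w
      any-any u∈ w∈ u≢w (yes refl) _          = p-any w∈ (≢-sym u≢w) (_ Fin.≟ q₂)
      any-any u∈ w∈ u≢w (no u≢p)   (yes refl) = adj-sym {B = B} (p-any u∈ u≢p (_ Fin.≟ q₂))
      any-any u∈ w∈ u≢w (no u≢p)   (no w≢p)   = proj₂ (twin u∈ _ (≢-sym u≢w) w≢p) (p-any w∈ w≢p (_ Fin.≟ q₂))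

      everything : ∀ i → i ∈ B
      everything i = [ (λ i∈inner →
          let u , w , u∈ , w∈ , e = inner⁻ {Vs = Vs} i∈inner
          in adj⇒∈ {B = B} e (any-any u∈ w∈ (ends-≢ {n} {i} e) (u Fin.≟ p) (w Fin.≟ p)))
        , (λ i∈o → T₀⊆B (outer⊆T₀ i∈o)) ]′ (inner⊎outer Vs i)

    nontwin : ∃ λ x → x ∈ₗ Vs × ¬ Twin B x p
    nontwin = find (All.¬All⇒Any¬ (λ x → twin? B x p) Vs ¬all-twins)

    -- Neighbours of p have to be removed from `Z₀` to obtain a disjoint `Y`, but deg p is not
    -- bounded yet. Truncating at this length limits the loss, and 2 (2 + Λ) neighbours are just
    -- enough for the contradiction in `∣N∣<C₀`.
    C₀ : ℕ
    C₀ = 2 * (2 + Λ)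

    A : List (Fin n)
    A = take C₀ (N p)

    Y : List (Fin n)
    Y = filter (λ z → ¬? (z ∈ₗ? A)) Z₀

    ∣A∣≤ : length A ≤ C₀
    ∣A∣≤ = subst (_≤ C₀) (sym (List.length-take C₀ (N p))) (ℕ.m⊓n≤m C₀ (length (N p)))

    ∈-Y⁻ : ∀ {y} → y ∈ₗ Y → y ∈ₗ Z₀ × y ∉ₗ A
    ∈-Y⁻ = ∈-filter⁻ (λ z → ¬? (z ∈ₗ? A)) {xs = Z₀}

    Y-unique : Unique Y
    Y-unique = Unique.filter⁺ (λ z → ¬? (z ∈ₗ? A)) Z₀-unique

    ∣Z₀∣≤ : length Z₀ ≤ length A + length Y
    ∣Z₀∣≤ = begin
      length Z₀                              ≡⟨ length-filter-∁ (_∈ₗ? A) (λ z → ¬? (z ∈ₗ? A)) Z₀ ⟩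
      length (filter (_∈ₗ? A) Z₀) + length Y ≤⟨ ℕ.+-monoˡ-≤ (length Y) (unique-⊆-length (Unique.filter⁺ (_∈ₗ? A) Z₀-unique)
                                                  (λ z∈ → proj₂ (∈-filter⁻ (_∈ₗ? A) {xs = Z₀} z∈))) ⟩
      length A + length Y                    ∎
      where open ℕ.≤-Reasoning

    t+∣Y∣∣A∣≤∣B∣ : t + length Y * length A ≤ ∣ B ∣
    t+∣Y∣∣A∣≤∣B∣ = t+product≤∣B∣ Y A Y-unique (Unique.take⁺ C₀ (N-unique p)) (λ y∈ → proj₁ (∈-Y⁻ y∈))
      (take-⊆ C₀) (λ y∈ → proj₂ (∈-Y⁻ y∈))

    ∣Y∣∣A∣<cost : ∀ {x} → x ∈ₗ Vs → ¬ Twin B x p → length Y * length A < length (N x) + suc Λ * length (N p)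
    ∣Y∣∣A∣<cost x∈ x≁p = ℕ.+-cancelˡ-< t _ _ (ℕ.≤-<-trans t+∣Y∣∣A∣≤∣B∣ (∣B∣<cost x∈ x≁p))

    module _ (enough : m + 2 * suc Λ + 2 * (C₀ + Λ) ≤ 2 * suc (length R)) where

      -- Of `p ∷ R` at most Λ vertices are lost on passing to `Z₀`, and at most `C₀` more on passing
      -- to `Y`. What is left is half of `Vs` with Λ + 1 to spare.
      m+2Λ≤2∣Y∣ : m + 2 * suc Λ ≤ 2 * length Y
      m+2Λ≤2∣Y∣ = ℕ.+-cancelʳ-≤ (2 * (C₀ + Λ)) _ _ (begin
        m + 2 * suc Λ + 2 * (C₀ + Λ)       ≤⟨ enough ⟩
        2 * suc (length R)                 ≤⟨ ℕ.*-monoʳ-≤ 2 ∣R∣≤ ⟩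
        2 * (length Z₀ + Λ)                ≤⟨ ℕ.*-monoʳ-≤ 2 (ℕ.+-monoˡ-≤ Λ (ℕ.≤-trans ∣Z₀∣≤ (ℕ.+-monoˡ-≤ (length Y) ∣A∣≤))) ⟩
        2 * (C₀ + length Y + Λ)            ≡⟨ rearrange (length Y) C₀ Λ ⟩
        2 * length Y + 2 * (C₀ + Λ)        ∎)
        where
        open ℕ.≤-Reasoning
        rearrange : ∀ y c l → 2 * (c + y + l) ≡ 2 * y + 2 * (c + l)
        rearrange = solve-∀

      -- With C₀ neighbours there are at least (2 + Λ) m edges between `Y` and `A`, while the cost
      -- is at most m + (Λ + 1) m because degrees do not exceed m. Hence the truncation in `A`
      -- removes nothing.
      ∣N∣<C₀ : length (N p) < C₀
      ∣N∣<C₀ = ℕ.≰⇒> λ C₀≤ → let x , x∈ , x≁p = nontwin in ℕ.<-irrefl refl (begin-strict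
        (2 + Λ) * m                             ≤⟨ ℕ.*-monoʳ-≤ (2 + Λ) (ℕ.≤-trans (ℕ.m≤m+n m (2 * suc Λ)) m+2Λ≤2∣Y∣) ⟩
        (2 + Λ) * (2 * length Y)                ≡⟨ rearrange Λ (length Y) ⟩
        length Y * C₀                           ≡⟨ cong (length Y *_) (trans (List.length-take C₀ (N p)) (ℕ.m≤n⇒m⊓n≡m C₀≤)) ⟨
        length Y * length A                     <⟨ ∣Y∣∣A∣<cost x∈ x≁p ⟩
        length (N x) + suc Λ * length (N p)     ≤⟨ ℕ.+-mono-≤ (∣N∣≤m x) (ℕ.*-monoʳ-≤ (suc Λ) (∣N∣≤m p)) ⟩
        (2 + Λ) * m                             ∎)
        where
        open ℕ.≤-Reasoning
        rearrange : ∀ l y → (2 + l) * (2 * y) ≡ y * (2 * (2 + l))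
        rearrange = solve-∀

      ∣A∣≡∣N∣ : length A ≡ length (N p)
      ∣A∣≡∣N∣ = trans (List.length-take C₀ (N p)) (ℕ.m≥n⇒m⊓n≡n (ℕ.<⇒≤ ∣N∣<C₀))

      ∣Y∣∣N∣<cost : ∀ {x} → x ∈ₗ Vs → ¬ Twin B x p → length Y * length (N p) < length (N x) + suc Λ * length (N p)
      ∣Y∣∣N∣<cost {x} x∈ x≁p =
        subst (λ l → length Y * l < length (N x) + suc Λ * length (N p)) ∣A∣≡∣N∣ (∣Y∣∣A∣<cost x∈ x≁p)

      -- For D = deg p ≥ 2 the half of `Vs` contained in 2 |Y| D contributes m D ≥ 2 m, which
      -- matches twice the bound m on deg x; the spare Λ + 1 matches the term (Λ + 1) D. The strict
      -- inequality on the cost is then violated.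
      ∣N∣<2 : length (N p) < 2
      ∣N∣<2 = ℕ.≰⇒> λ 2≤D → let x , x∈ , x≁p = nontwin ; D = length (N p) in ℕ.<-irrefl refl (begin-strict
        m * 2 + 2 * (suc Λ * D)          ≤⟨ ℕ.+-monoˡ-≤ (2 * (suc Λ * D)) (ℕ.*-monoʳ-≤ m 2≤D) ⟩
        m * D + 2 * (suc Λ * D)          ≡⟨ rearrange m Λ D ⟩
        (m + 2 * suc Λ) * D              ≤⟨ ℕ.*-monoˡ-≤ D m+2Λ≤2∣Y∣ ⟩
        2 * length Y * D                 ≡⟨ ℕ.*-assoc 2 (length Y) D ⟩
        2 * (length Y * D)               <⟨ ℕ.*-monoʳ-< 2 (∣Y∣∣N∣<cost x∈ x≁p) ⟩
        2 * (length (N x) + suc Λ * D)   ≤⟨ ℕ.*-monoʳ-≤ 2 (ℕ.+-monoˡ-≤ (suc Λ * D) (∣N∣≤m x)) ⟩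
        2 * (m + suc Λ * D)              ≡⟨ rearrange′ m (suc Λ * D) ⟩
        m * 2 + 2 * (suc Λ * D)          ∎)
        where
        open ℕ.≤-Reasoning
        rearrange : ∀ m l d → m * d + 2 * ((1 + l) * d) ≡ (m + 2 * (1 + l)) * d
        rearrange = solve-∀
        rearrange′ : ∀ m s → 2 * (m + s) ≡ m * 2 + 2 * s
        rearrange′ = solve-∀

      leaf-N : ∀ {q q′} → Leaf Vs T₀ q q′ → Twin B q p → q ∈ₗ N p ⊎ q′ ∈ₗ N p
      leaf-N leaf@(q∈ , q′∈ , _) q~p = twin⇒N q∈ q′∈ q~p (Leaf⇒adj leaf)

      -- Every vertex of `Vs` other than a turns out to be a twin of p, so every edge of B inside
      -- `Vs` that has an end besides a must meet a. But q₁q₂ and q₃q₄ are disjoint, and one of them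
      -- misses a.
      N≢[a] : ∀ {a} → N p ≢ [ a ]
      N≢[a] {a} N≡[a] = by-seed (q₁ Fin.≟ a) (q₂ Fin.≟ a)
        where
        open ℕ.≤-Reasoning

        ∈N⇒≡a : ∀ {x} → x ∈ₗ N p → x ≡ a
        ∈N⇒≡a {x} x∈ with subst (x ∈ₗ_) N≡[a] x∈
        ... | here x≡a = x≡a

        ∣N∣+∣Y∣≤m : ∀ {x} → x ∈ₗ Vs → x ≢ a → ¬ Twin B x p → length (N x) + length Y ≤ m
        ∣N∣+∣Y∣≤m {x} x∈ x≢a x≁p = subst (_≤ m) (List.length-++ (N x))
          (unique-⊆-length (Unique.++⁺ (N-unique x) Y-unique λ (y∈N , y∈Y) → disjoint y∈N y∈Y)
            (λ y∈ → [ (λ y∈N → proj₁ (∈-N⁻ {x} y∈N)) , (λ y∈Y → pR⊆Vs (Z₀⊆pR (proj₁ (∈-Y⁻ y∈Y)))) ]′ (∈-++⁻ (N x) y∈)))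
          where
          disjoint : ∀ {y} → y ∈ₗ N x → ¬ y ∈ₗ Y
          disjoint {y} y∈N y∈Y =
            let y~p = Z₀-twin (proj₁ (∈-Y⁻ y∈Y))
                x-y = proj₂ (∈-N⁻ {x} y∈N)
                p-x = proj₁ (y~p x (adj-≢ {B = B} x-y) (λ { refl → x≁p (twin-refl {B = B}) })) (adj-sym {B = B} x-y)
            in x≢a (∈N⇒≡a (∈-filter⁺ (adj? B p) x∈ p-x))

        twin : ∀ {x} → x ∈ₗ Vs → x ≢ a → Twin B x p
        -- No vertex of `Y` is adjacent to x, since its twin p would be too, forcing x = a. So deg x
        -- + |Y| ≤ m, which together with |Y| < deg x + Λ + 1 contradicts the size of `Y`.
        twin {x} x∈ x≢a = decidable-stable (twin? B x p) λ x≁p → ℕ.<-irrefl refl (begin-strict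
          m + 2 * suc Λ                                ≤⟨ m+2Λ≤2∣Y∣ ⟩
          2 * length Y                                 ≡⟨ rearrange (length Y) ⟩
          length Y * 1 + length Y                      <⟨ ℕ.+-monoˡ-< (length Y) (subst (λ xs → length Y * length xs < length (N x) + suc Λ * length xs)
                                                            N≡[a] (∣Y∣∣N∣<cost x∈ x≁p)) ⟩
          length (N x) + suc Λ * 1 + length Y          ≡⟨ rearrange′ (length (N x)) (suc Λ) (length Y) ⟩
          length (N x) + length Y + suc Λ              ≤⟨ ℕ.+-mono-≤ (∣N∣+∣Y∣≤m x∈ x≢a x≁p) (ℕ.m≤n*m (suc Λ) 2) ⟩
          m + 2 * suc Λ                                ∎)
          where
          rearrange : ∀ y → 2 * y ≡ y * 1 + y
          rearrange = solve-∀
          rearrange′ : ∀ x s y → x + s * 1 + y ≡ x + y + s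
          rearrange′ = solve-∀

        off-a : ∀ {q q′} → Leaf Vs T₀ q q′ → q ≢ a → q′ ≢ a → ⊥
        off-a leaf q≢a q′≢a = [ q≢a ∘ ∈N⇒≡a , q′≢a ∘ ∈N⇒≡a ]′ (leaf-N leaf (twin (proj₁ leaf) q≢a))

        by-seed : Dec (q₁ ≡ a) → Dec (q₂ ≡ a) → ⊥
        by-seed (yes refl) _          = off-a leaf₃ (≢-sym q₁≢q₃) (≢-sym q₁≢q₄)
        by-seed (no _)     (yes refl) = off-a leaf₃ (≢-sym q₂≢q₃) (≢-sym q₂≢q₄)
        by-seed (no q₁≢a)  (no q₂≢a)  = off-a leaf₁ q₁≢a q₂≢a

      -- A new edge of B misses one of the three leaves; removing the edges at
      -- that leaf costs at most as many edges as B has more than t.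
      N≢[] : N p ≢ []
      N≢[] N≡[] = by-leaf (q₁ ∈? ends e) (q₂ ∈? ends e) (q₃ ∈? ends e)
        where
        ∉N : ∀ {x} → x ∉ₗ N p
        ∉N {x} x∈ with subst (x ∈ₗ_) N≡[] x∈
        ... | ()

        new-edge : ∃ λ i → i ∈ B × i ∉ T₀
        new-edge = decidable-stable (Fin.any? λ i → (i ∈? B) ×-dec ¬? (i ∈? T₀)) λ none →
          ℕ.<⇒≱ t<∣B∣ (ℕ.≤-trans (p⊆q⇒∣p∣≤∣q∣ {p = B} {q = T₀} λ {i} i∈B →
            decidable-stable (i ∈? T₀) λ i∉T₀ → none (i , i∈B , i∉T₀)) (ℕ.≤-reflexive ∣T₀∣≡t))

        e = proj₁ new-edge
        e∈B = proj₁ (proj₂ new-edge)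
        e∉T₀ = proj₂ (proj₂ new-edge)

        e∈inner : e ∈ inner Vs
        e∈inner = [ id , (λ e∈o → contradiction (outer⊆T₀ e∈o) e∉T₀) ]′ (inner⊎outer Vs e)

        Z-isolated : ∀ {z i} → z ∈ₗ Z₀ → i ∈ B → i ∈ inner Vs → z ∉ ends i
        Z-isolated {z} {i} z∈ i∈B i∈inner z∈e =
          let w , w∈ , e′ = inner-other {Vs = Vs} i∈inner z∈e
          in [ ∉N , ∉N ]′ (twin⇒N (pR⊆Vs (Z₀⊆pR z∈)) w∈ (Z₀-twin z∈) (i , e′ , i∈B))

        module _ {q q′ : Fin n} (leaf : Leaf Vs T₀ q q′) (q∉e : q ∉ ends e) where

          kept⁺ : ∀ {i} → i ∈ B → i ∈ inner Vs → q ∉ ends i → i ∈ kept q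
          kept⁺ i∈B i∈inner q∉i = ∈-subset⁺ (kept? q)
            (i∈B , inj₂ (q∉i ∷ All.tabulate λ z∈ → Z-isolated (Z⊆Z₀ z∈) i∈B i∈inner))

          in-T₀ : ∀ i → i ∈ T₀ → Dec (q ∈ ends i) → i ∈ inner Vs ⊎ i ∈ outer Vs → ends i ∈ₗ pair q q′ ∷ endsOf (kept q)
          in-T₀ i i∈T₀ _         (inj₂ i∈o) = there (∈-endsOf⁺ {B = kept q} (∈-subset⁺ (kept? q) (T₀⊆B i∈T₀ , inj₁ i∈o)))
          in-T₀ i i∈T₀ (yes q∈i) (inj₁ i∈inner) = here (proj₂ (proj₂ (proj₂ leaf)) i∈T₀ i∈inner q∈i)
          in-T₀ i i∈T₀ (no q∉i)  (inj₁ i∈inner) = there (∈-endsOf⁺ {B = kept q} (kept⁺ (T₀⊆B i∈T₀) i∈inner q∉i))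

          remaining : ∀ {s} → s ∈ₗ ends e ∷ endsOf T₀ → s ∈ₗ pair q q′ ∷ endsOf (kept q)
          remaining (here refl) = there (∈-endsOf⁺ {B = kept q} (kept⁺ e∈B e∈inner q∉e))
          remaining (there s∈)  =
            let i , i∈T₀ , e′ = ∈-endsOf⁻ {B = T₀} s∈
            in subst (_∈ₗ pair q q′ ∷ endsOf (kept q)) (sym e′) (in-T₀ i i∈T₀ (q ∈? ends i) (inner⊎outer Vs i))

          new∷T₀-unique : Unique (ends e ∷ endsOf T₀)
          new∷T₀-unique = All.tabulate (λ s∈ e≡s → let i , i∈T₀ , s≡ = ∈-endsOf⁻ {B = T₀} s∈ in
              e∉T₀ (subst (_∈ T₀) (ends-injective {n} (sym (trans e≡s s≡))) i∈T₀))
            ∷ endsOf-unique T₀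

          absurd : ⊥
          -- `kept q` gains the new edge e and loses from T₀ at most the edge qq′, so it still has t
          -- edges; `Z` costs nothing because deg p = 0.
          absurd = ℕ.<⇒≱ (∣kept∣<t (proj₁ leaf) λ q~p → [ ∉N , ∉N ]′ (leaf-N leaf q~p))
            (subst₂ _≤_ (trans (length-endsOf {n} T₀) ∣T₀∣≡t) (length-endsOf {n} (kept q))
              (s≤s⁻¹ (unique-⊆-length new∷T₀-unique remaining)))

        by-leaf : Dec (q₁ ∈ ends e) → Dec (q₂ ∈ ends e) → Dec (q₃ ∈ ends e) → ⊥
        by-leaf (no q₁∉) _        _        = absurd leaf₁ q₁∉
        by-leaf (yes _)  (no q₂∉) _        = absurd leaf₂ q₂∉
        by-leaf (yes _)  (yes _)  (no q₃∉) = absurd leaf₃ q₃∉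
        by-leaf (yes q₁∈) (yes q₂∈) (yes q₃∈) = three (ends-pair {n} e)
          where
          q₁≢q₂ = adj-≢ {B = B} (Leaf⇒adj leaf₁)

          three : (∃₂ λ u w → u ≢ w × ends e ≡ pair u w) → ⊥
          three (u , w , _ , e≡)
            with ∈-pair⁻ (subst (q₁ ∈_) e≡ q₁∈) | ∈-pair⁻ (subst (q₂ ∈_) e≡ q₂∈) | ∈-pair⁻ (subst (q₃ ∈_) e≡ q₃∈)
          ... | inj₁ a | inj₁ b | _      = q₁≢q₂ (trans a (sym b))
          ... | inj₁ a | inj₂ b | inj₁ c = q₁≢q₃ (trans a (sym c))
          ... | inj₁ a | inj₂ b | inj₂ c = q₂≢q₃ (trans b (sym c))
          ... | inj₂ a | inj₁ b | inj₁ c = q₂≢q₃ (trans b (sym c))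
          ... | inj₂ a | inj₁ b | inj₂ c = q₁≢q₃ (trans a (sym c))
          ... | inj₂ a | inj₂ b | _      = q₁≢q₂ (trans a (sym b))

  -- At most Λ elements of `p ∷ R` are missing from `Z₀`, and `enough` makes `R` much longer than 2
  -- Λ. This guarantees that `Z` really has Λ + 1 elements.
  Λ<∣Z₀∣ : m + 2 * suc Λ + 2 * (2 * (2 + Λ) + Λ) ≤ 2 * suc (length R) → Λ < length Z₀
  Λ<∣Z₀∣ enough = ℕ.≰⇒> λ ∣Z₀∣≤Λ → ℕ.<-irrefl refl (begin-strict
    m + 2 * suc Λ + 2 * (2 * (2 + Λ) + Λ)   ≤⟨ enough ⟩
    2 * suc (length R)                      ≤⟨ ℕ.*-monoʳ-≤ 2 ∣R∣≤ ⟩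
    2 * (length Z₀ + Λ)                     ≤⟨ ℕ.*-monoʳ-≤ 2 (ℕ.+-monoˡ-≤ Λ ∣Z₀∣≤Λ) ⟩
    2 * (Λ + Λ)                             <⟨ ℕ.m<m+n (2 * (Λ + Λ)) (s≤s z≤n) ⟩
    2 * (Λ + Λ) + suc (9 + 4 * Λ + m)       ≡⟨ rearrange m Λ ⟩
    m + 2 * suc Λ + 2 * (2 * (2 + Λ) + Λ)   ∎)
    where
    open ℕ.≤-Reasoning
    rearrange : ∀ m l → 2 * (l + l) + (1 + (9 + 4 * l + m)) ≡ m + 2 * (1 + l) + 2 * (2 * (2 + l) + l)
    rearrange = solve-∀

  impossible : m + 2 * suc Λ + 2 * (2 * (2 + Λ) + Λ) ≤ 2 * suc (length R) → ⊥
  impossible enough = by-degree (N p) refl (∣N∣<2 (Λ<∣Z₀∣ enough) enough)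
    where
    by-degree : ∀ xs → N p ≡ xs → length (N p) < 2 → ⊥
    by-degree []          N≡ _ = N≢[] (Λ<∣Z₀∣ enough) enough N≡
    by-degree (a ∷ [])    N≡ _ = N≢[a] (Λ<∣Z₀∣ enough) enough N≡
    by-degree (_ ∷ _ ∷ _) N≡ D<2 = ℕ.<⇒≱ D<2 (subst (λ xs → 2 ≤ length xs) (sym N≡) (s≤s (s≤s z≤n)))

-- Choosing the vertex set Vs and the t-set T₀

module _ {n : ℕ} where

  -- Dropping a vertex from Vs loses fewer than length Vs inner edges, so
  -- ∣ inner Vs ∣ + t hits the required interval on the way down from v + t.
  window : ∀ {t} → t < n C 2 → (Vs : List (Fin n)) → Unique Vs → n C 2 + 2 ≤ ∣ inner Vs ∣ + t →
           ∃ λ Ws → Unique Ws × n C 2 + 2 ≤ ∣ inner Ws ∣ + t × ∣ inner Ws ∣ + t ≤ n C 2 + suc (length Ws)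
  window {t} t<v [] _ v+2≤ = contradiction (begin
    n C 2                  ≤⟨ ℕ.m≤m+n (n C 2) 2 ⟩
    n C 2 + 2              ≤⟨ v+2≤ ⟩
    ∣ inner {n} [] ∣ + t   ≤⟨ ℕ.+-monoˡ-≤ t (∣inner∣≤ {n} []) ⟩
    t                      ∎) (ℕ.<⇒≱ t<v)
    where open ℕ.≤-Reasoning
  window {t} t<v (x ∷ Vs) u v+2≤ = choose (∣ inner (x ∷ Vs) ∣ + t ℕ.≤? n C 2 + suc (length (x ∷ Vs)))
    where
    choose : Dec (∣ inner (x ∷ Vs) ∣ + t ≤ n C 2 + suc (length (x ∷ Vs))) →
             ∃ λ Ws → Unique Ws × n C 2 + 2 ≤ ∣ inner Ws ∣ + t × ∣ inner Ws ∣ + t ≤ n C 2 + suc (length Ws)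
    choose (yes small) = x ∷ Vs , u , v+2≤ , small
    -- Above the interval there is an excess of more than |Vs| over `n C 2 + 2`, and dropping x
    -- loses at most |Vs|.
    choose (no large)  = window t<v Vs (AllPairs.tail u) (ℕ.+-cancelʳ-≤ (length Vs) _ _ (begin
      n C 2 + 2 + length Vs                    ≡⟨ ℕ.+-assoc (n C 2) 2 (length Vs) ⟩
      n C 2 + suc (length (x ∷ Vs))            ≤⟨ ℕ.<⇒≤ (ℕ.≰⇒> large) ⟩
      ∣ inner (x ∷ Vs) ∣ + t                   ≤⟨ ℕ.+-monoˡ-≤ t (∣inner-∷∣≤ x Vs) ⟩
      ∣ inner Vs ∣ + length Vs + t             ≡⟨ rearrange ∣ inner Vs ∣ (length Vs) t ⟩
      ∣ inner Vs ∣ + t + length Vs             ∎))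
      where
      open ℕ.≤-Reasoning
      rearrange : ∀ e l t → e + l + t ≡ e + t + l
      rearrange = solve-∀

-- T₀ will consist of the outer edges, the seeds q₁q₂ and q₃q₄, and some of the
-- edges between Y₁ and Y₂, so that the vertices p ∷ R are isolated inside Vs.
module Window {n : ℕ} (q₁ q₂ q₃ q₄ p : Fin n) (Y₁ Y₂ R : List (Fin n))
  (unique : Unique (q₁ ∷ q₂ ∷ q₃ ∷ q₄ ∷ Y₁ ++ Y₂ ++ p ∷ R)) where

  open DecMembership (Vec.≡-dec {n = n} Bool._≟_) using () renaming (_∈?_ to _∈ₛ?_)

  Vs rest : List (Fin n)
  rest = Y₁ ++ Y₂ ++ p ∷ R
  Vs   = q₁ ∷ q₂ ∷ q₃ ∷ q₄ ∷ rest

  private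
    o = outer Vs

    u₂ = AllPairs.tail unique
    u₃ = AllPairs.tail u₂
    u₄ = AllPairs.tail u₃
    rest-unique = AllPairs.tail u₄
    Y₂pR-unique = unique-++ʳ Y₁ rest-unique

    q₁∈ : q₁ ∈ₗ Vs
    q₁∈ = here refl
    q₂∈ : q₂ ∈ₗ Vs
    q₂∈ = there (here refl)
    q₃∈ : q₃ ∈ₗ Vs
    q₃∈ = there (there (here refl))
    q₄∈ : q₄ ∈ₗ Vs
    q₄∈ = there (there (there (here refl)))

    rest⊆Vs : ∀ {x} → x ∈ₗ rest → x ∈ₗ Vs
    rest⊆Vs x∈ = there (there (there (there x∈)))

    Y₁⊆rest : ∀ {x} → x ∈ₗ Y₁ → x ∈ₗ rest
    Y₁⊆rest = ∈-++⁺ˡ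
    Y₂⊆rest : ∀ {x} → x ∈ₗ Y₂ → x ∈ₗ rest
    Y₂⊆rest = ∈-++⁺ʳ Y₁ ∘ ∈-++⁺ˡ
    pR⊆rest : ∀ {x} → x ∈ₗ p ∷ R → x ∈ₗ rest
    pR⊆rest = ∈-++⁺ʳ Y₁ ∘ ∈-++⁺ʳ Y₂

    q₁∉rest : q₁ ∉ₗ rest
    q₁∉rest x∈ = All.lookup (AllPairs.head unique) (there (there (there x∈))) refl
    q₂∉rest : q₂ ∉ₗ rest
    q₂∉rest x∈ = All.lookup (AllPairs.head u₂) (there (there x∈)) refl
    q₃∉rest : q₃ ∉ₗ rest
    q₃∉rest x∈ = All.lookup (AllPairs.head u₃) (there x∈) refl
    q₄∉rest : q₄ ∉ₗ rest
    q₄∉rest x∈ = All.lookup (AllPairs.head u₄) x∈ refl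

    q₁≢q₂ : q₁ ≢ q₂
    q₁≢q₂ = All.lookup (AllPairs.head unique) (here refl)
    q₁≢q₃ : q₁ ≢ q₃
    q₁≢q₃ = All.lookup (AllPairs.head unique) (there (here refl))
    q₁≢q₄ : q₁ ≢ q₄
    q₁≢q₄ = All.lookup (AllPairs.head unique) (there (there (here refl)))
    q₂≢q₃ : q₂ ≢ q₃
    q₂≢q₃ = All.lookup (AllPairs.head u₂) (here refl)
    q₂≢q₄ : q₂ ≢ q₄
    q₂≢q₄ = All.lookup (AllPairs.head u₂) (there (here refl))
    q₃≢q₄ : q₃ ≢ q₄
    q₃≢q₄ = All.lookup (AllPairs.head u₃) (here refl)

    Y₁∩Y₂ : ∀ {x} → x ∈ₗ Y₁ → x ∉ₗ Y₂
    Y₁∩Y₂ x∈ x∈′ = unique-++-disjoint Y₁ rest-unique x∈ (∈-++⁺ˡ x∈′)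

  seeds extra : List (Subset n)
  seeds = pair q₁ q₂ ∷ pair q₃ q₄ ∷ []
  extra = cartesianProductWith pair Y₁ Y₂

  private
    extra-ends : ∀ {s x} → s ∈ₗ extra → x ∈ s → x ∈ₗ Y₁ ⊎ x ∈ₗ Y₂
    extra-ends s∈ x∈ =
      let a , b , a∈ , b∈ , e = ∈-cartesianProductWith⁻ pair Y₁ Y₂ s∈
      in [ (λ { refl → inj₁ a∈ }) , (λ { refl → inj₂ b∈ }) ]′ (∈-pair⁻ (subst (_ ∈_) e x∈))

    extra-ends⊆rest : ∀ {s x} → s ∈ₗ extra → x ∈ s → x ∈ₗ rest
    extra-ends⊆rest s∈ x∈ = [ Y₁⊆rest , Y₂⊆rest ]′ (extra-ends s∈ x∈)

    seeds++extra-pairs : ∀ {s} → s ∈ₗ seeds ++ extra → ∃₂ λ x y → x ∈ₗ Vs × y ∈ₗ Vs × x ≢ y × s ≡ pair x y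
    seeds++extra-pairs (here e)           = q₁ , q₂ , q₁∈ , q₂∈ , q₁≢q₂ , e
    seeds++extra-pairs (there (here e))   = q₃ , q₄ , q₃∈ , q₄∈ , q₃≢q₄ , e
    seeds++extra-pairs (there (there s∈)) =
      let a , b , a∈ , b∈ , e = ∈-cartesianProductWith⁻ pair Y₁ Y₂ s∈
      in a , b , rest⊆Vs (Y₁⊆rest a∈) , rest⊆Vs (Y₂⊆rest b∈) ,
         (λ a≡b → Y₁∩Y₂ a∈ (subst (_∈ₗ Y₂) (sym a≡b) b∈)) , e

    seeds++extra-unique : Unique (seeds ++ extra)
    seeds++extra-unique =
      ((λ e → [ (λ (q₁≡q₃ , _) → q₁≢q₃ q₁≡q₃) , (λ (q₁≡q₄ , _) → q₁≢q₄ q₁≡q₄) ]′ (pair-injective q₁≢q₂ e))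
        ∷ All.tabulate λ s∈ e → q₁∉rest (extra-ends⊆rest s∈ (subst (q₁ ∈_) e ∈-pairˡ)))
      ∷ All.tabulate (λ s∈ e → q₃∉rest (extra-ends⊆rest s∈ (subst (q₃ ∈_) e ∈-pairˡ)))
      ∷ cartesianProductWith-unique pair (unique-++ˡ Y₁ rest-unique) (unique-++ˡ Y₂ Y₂pR-unique)
          λ a∈ b∈ c∈ d∈ e → [ id , (λ { (refl , _) → contradiction d∈ (Y₁∩Y₂ a∈) }) ]′
            (pair-injective (λ { refl → Y₁∩Y₂ a∈ b∈ }) e)

    OuterOr : List (Subset n) → Fin (n C 2) → Set
    OuterOr S i = i ∈ o ⊎ ends i ∈ₗ S

    outerOr? : ∀ S → Decidable (OuterOr S)
    outerOr? S i = (i ∈? o) ⊎-dec (ends i ∈ₛ? S)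

    -- The limits between which T₀ is interpolated: no extra edges, or all of them.
    low high : Edges n
    low  = subset (outerOr? seeds)
    high = subset (outerOr? (seeds ++ extra))

    low⊆high : low ⊆ high
    low⊆high i∈ = ∈-subset⁺ (outerOr? (seeds ++ extra)) (Sum.map₂ ∈-++⁺ˡ (∈-subset⁻ (outerOr? seeds) i∈))

    ∣low∣≤ : ∣ low ∣ ≤ ∣ o ∣ + 2
    ∣low∣≤ = subst (∣ low ∣ ≤_) (length-++-≡ (endsOf o) seeds (length-endsOf {n} o) refl)
      (∣∣≤length {B = low} λ i∈ → [ ∈-++⁺ˡ ∘ ∈-endsOf⁺ {B = o} , ∈-++⁺ʳ (endsOf o) ]′ (∈-subset⁻ (outerOr? seeds) i∈))

    ≤∣high∣ : ∣ o ∣ + (2 + length Y₁ * length Y₂) ≤ ∣ high ∣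
    ≤∣high∣ = subst (_≤ ∣ high ∣)
      (length-++-≡ (endsOf o) (seeds ++ extra) (length-endsOf {n} o) (cong (2 +_) (length-cartesianProductWith pair Y₁ Y₂)))
      (length≤∣∣ {B = high} {xs = endsOf o ++ seeds ++ extra}
        (Unique.++⁺ (endsOf-unique o) seeds++extra-unique λ (s∈ , s∈′) → disjoint s∈ s∈′)
        (λ s∈ → [ in-outer , in-rest ]′ (∈-++⁻ (endsOf o) s∈)))
      where
      disjoint : ∀ {s} → s ∈ₗ endsOf o → ¬ s ∈ₗ seeds ++ extra
      disjoint s∈ s∈′ =
        let i , i∈o , e = ∈-endsOf⁻ {B = o} s∈
            x , y , x∈ , y∈ , _ , e′ = seeds++extra-pairs s∈′
        in x∈∁p⇒x∉p i∈o (inner⁺ x∈ y∈ (trans (sym e) e′))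

      in-outer : ∀ {s} → s ∈ₗ endsOf o → s ∈ₗ endsOf high
      in-outer s∈ =
        let i , i∈o , e = ∈-endsOf⁻ {B = o} s∈
        in subst (_∈ₗ endsOf high) (sym e) (∈-endsOf⁺ {B = high} (∈-subset⁺ (outerOr? (seeds ++ extra)) (inj₁ i∈o)))

      in-rest : ∀ {s} → s ∈ₗ seeds ++ extra → s ∈ₗ endsOf high
      in-rest s∈ =
        let x , y , _ , _ , x≢y , e = seeds++extra-pairs s∈
            i , e′ = edge x≢y
            e″ = trans e (sym e′)
        in subst (_∈ₗ endsOf high) (sym e″) (∈-endsOf⁺ {B = high}
             (∈-subset⁺ (outerOr? (seeds ++ extra)) (inj₂ (subst (_∈ₗ seeds ++ extra) e″ s∈))))

  record Start (t : ℕ) (T : Edges n) : Set where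
    field
      size     : ∣ T ∣ ≡ t
      ⊇outer   : outer Vs ⊆ T
      leaf₁    : Leaf Vs T q₁ q₂
      leaf₂    : Leaf Vs T q₂ q₁
      leaf₃    : Leaf Vs T q₃ q₄
      isolated : ∀ {z} → z ∈ₗ p ∷ R → Avoids Vs T z

  -- Any t-set between `low` and `high` will do. Inside `Vs` it consists of both seeds and some
  -- edges between `Y₁` and `Y₂`, which touch neither the vertices q₁, ..., q₄ nor those of `p ∷ R`.
  start : ∀ {t} → ∣ outer Vs ∣ + 2 ≤ t → t ≤ ∣ outer Vs ∣ + (2 + length Y₁ * length Y₂) → ∃ (Start t)
  start {t} o+2≤t t≤ with interpolate low high low⊆high (ℕ.≤-trans ∣low∣≤ o+2≤t) (ℕ.≤-trans t≤ ≤∣high∣)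
  ... | T , low⊆T , T⊆high , ∣T∣≡t = T , record
    { size     = ∣T∣≡t
    ; ⊇outer   = λ i∈o → low⊆T (∈-subset⁺ (outerOr? seeds) (inj₁ i∈o))
    ; leaf₁    = q₁∈ , q₂∈ , seed q₁≢q₂ (here refl) ,
                 leaf q₁∉rest λ { (here e) _ → e
                                ; (there (here e)) q∈ → contradiction (subst (q₁ ∈_) e q∈) ([ q₁≢q₃ , q₁≢q₄ ]′ ∘ ∈-pair⁻) }
    ; leaf₂    = q₂∈ , q₁∈ , adj-sym {B = T} (seed q₁≢q₂ (here refl)) ,
                 leaf q₂∉rest λ { (here e) _ → trans e (pair-comm q₁ q₂)
                                ; (there (here e)) q∈ → contradiction (subst (q₂ ∈_) e q∈) ([ q₂≢q₃ , q₂≢q₄ ]′ ∘ ∈-pair⁻) }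
    ; leaf₃    = q₃∈ , q₄∈ , seed q₃≢q₄ (there (here refl)) ,
                 leaf q₃∉rest λ { (there (here e)) _ → e
                                ; (here e) q∈ → contradiction (subst (q₃ ∈_) e q∈) ([ ≢-sym q₁≢q₃ , ≢-sym q₂≢q₃ ]′ ∘ ∈-pair⁻) }
    ; isolated = λ z∈ i i∈T i∈inner z∈i → [ seed-isolated z∈ z∈i , extra-isolated z∈ z∈i ]′ (∈-++⁻ seeds (inside-T i∈T i∈inner))
    }
    where
    inside-T : ∀ {i} → i ∈ T → i ∈ inner Vs → ends i ∈ₗ seeds ++ extra
    inside-T i∈T i∈inner = [ (λ i∈o → contradiction i∈inner (x∈∁p⇒x∉p i∈o)) , id ]′
      (∈-subset⁻ (outerOr? (seeds ++ extra)) (T⊆high i∈T))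

    seed : ∀ {x y} → x ≢ y → pair x y ∈ₗ seeds → Adj T x y
    seed x≢y s∈ = let i , e = edge x≢y in
      i , e , low⊆T (∈-subset⁺ (outerOr? seeds) (inj₂ (subst (_∈ₗ seeds) (sym e) s∈)))

    leaf : ∀ {q q′} → q ∉ₗ rest → (∀ {s} → s ∈ₗ seeds → q ∈ s → s ≡ pair q q′) →
           ∀ {i} → i ∈ T → i ∈ inner Vs → q ∈ ends i → ends i ≡ pair q q′
    leaf q∉rest h i∈T i∈inner q∈ =
      [ (λ s∈ → h s∈ q∈) , (λ s∈ → contradiction (extra-ends⊆rest s∈ q∈) q∉rest) ]′ (∈-++⁻ seeds (inside-T i∈T i∈inner))

    seed-isolated : ∀ {z i} → z ∈ₗ p ∷ R → z ∈ ends {n} i → ¬ ends i ∈ₗ seeds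
    seed-isolated z∈ z∈i (here e)         =
      [ (λ { refl → q₁∉rest (pR⊆rest z∈) }) , (λ { refl → q₂∉rest (pR⊆rest z∈) }) ]′ (∈-pair⁻ (subst (_ ∈_) e z∈i))
    seed-isolated z∈ z∈i (there (here e)) =
      [ (λ { refl → q₃∉rest (pR⊆rest z∈) }) , (λ { refl → q₄∉rest (pR⊆rest z∈) }) ]′ (∈-pair⁻ (subst (_ ∈_) e z∈i))

    extra-isolated : ∀ {z i} → z ∈ₗ p ∷ R → z ∈ ends {n} i → ¬ ends i ∈ₗ extra
    extra-isolated z∈ z∈i s∈ = [ (λ z∈Y₁ → unique-++-disjoint Y₁ rest-unique z∈Y₁ (∈-++⁺ʳ Y₂ z∈))
                               , (λ z∈Y₂ → unique-++-disjoint Y₂ Y₂pR-unique z∈Y₂ z∈) ]′ (extra-ends s∈ z∈i)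

  no-block : ∀ {t Λ T} B → Start t T → T ⊆ B → FewNontwins t Λ B → t < ∣ B ∣ → ∣ B ∣ < n C 2 →
             ¬ length Vs + 2 * suc Λ + 2 * (2 * (2 + Λ) + Λ) ≤ 2 * suc (length R)
  no-block {t} {Λ} {T} B st T⊆B few t<∣B∣ ∣B∣<v = Block.impossible B T few Vs unique (Start.⊇outer st) T⊆B (Start.size st)
    t<∣B∣ ∣B∣<v p R (unique-++ʳ Y₂ Y₂pR-unique) (λ z∈ → rest⊆Vs (pR⊆rest z∈)) (Start.isolated st)
    q₁ q₂ q₃ q₄ (Start.leaf₁ st) (Start.leaf₂ st) (Start.leaf₃ st) q₁≢q₃ q₁≢q₄ q₂≢q₃ q₂≢q₄
    (λ q₂≡p → q₂∉rest (pR⊆rest (here q₂≡p)))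

-- The bound on n

-- With 8 vertices in `Y₁` and about m / 8 in `Y₂` there are at least m extra edges, yet some seven
-- eighths of `Vs` remain for `R`. Matching on this type turns a list into the concatenation that
-- `Window` expects.
data Split {A : Set} (h r : ℕ) : List A → Set where
  split : ∀ q₁ q₂ q₃ q₄ p Y₁ Y₂ R → length Y₁ ≡ 8 → length Y₂ ≡ h → length R ≡ r →
          Split h r (q₁ ∷ q₂ ∷ q₃ ∷ q₄ ∷ Y₁ ++ Y₂ ++ p ∷ R)

toSplit : ∀ {A : Set} h r (xs : List A) → length xs ≡ 4 + (8 + (h + suc r)) → Split h r xs
toSplit h r (q₁ ∷ q₂ ∷ q₃ ∷ q₄ ∷ xs) e with splitAt-length 8 xs (ℕ.+-cancelˡ-≡ 4 _ _ e)
... | Y₁ , ys , refl , e₁ , e₂ with splitAt-length h ys e₂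
...   | Y₂ , p ∷ R , refl , e₃ , e₄ = split q₁ q₂ q₃ q₄ p Y₁ Y₂ R e₁ e₃ (ℕ.suc-injective e₄)

-- The quotient plus one serves even when 8 divides m, whence m + 8 as the upper bound.
8*⌈m/8⌉ : ∀ m → ∃ λ h → m ≤ 8 * h × 8 * h ≤ m + 8
8*⌈m/8⌉ m = suc (m / 8) , lower , upper
  where
  open ℕ.≤-Reasoning

  8*suc : ∀ q → 8 * suc q ≡ 8 + q * 8
  8*suc q = trans (ℕ.*-suc 8 q) (cong (8 +_) (ℕ.*-comm 8 q))

  lower : m ≤ 8 * suc (m / 8)
  lower = begin
    m                      ≡⟨ m≡m%n+[m/n]*n m 8 ⟩
    m % 8 + m / 8 * 8      ≤⟨ ℕ.+-monoˡ-≤ (m / 8 * 8) (ℕ.<⇒≤ (m%n<n m 8)) ⟩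
    8 + m / 8 * 8          ≡⟨ 8*suc (m / 8) ⟨
    8 * suc (m / 8)        ∎

  upper : 8 * suc (m / 8) ≤ m + 8
  upper = begin
    8 * suc (m / 8)        ≡⟨ 8*suc (m / 8) ⟩
    8 + m / 8 * 8          ≤⟨ ℕ.+-monoʳ-≤ 8 (m/n*n≤m m 8) ⟩
    8 + m                  ≡⟨ ℕ.+-comm 8 m ⟩
    m + 8                  ∎

nonempty : ∀ {A : Set} {xs : List A} → 0 < length xs → ∃ (_∈ₗ xs)
nonempty {xs = x ∷ _} _ = x , here refl

n≤1+nC2 : ∀ n → n ≤ suc (n C 2)
n≤1+nC2 zero    = z≤n
n≤1+nC2 (suc n) = s≤s (begin
  n               ≡⟨ nC1≡n n ⟨
  n C 1           ≤⟨ ℕ.m≤m+n (n C 1) (n C 2) ⟩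
  n C 1 + n C 2   ≡⟨ nCk+nC[k+1]≡[n+1]C[k+1] n 1 ⟩
  suc n C 2       ∎)
  where open ℕ.≤-Reasoning

-- Large enough for the inequalities fits and enough.
threshold : ℕ → ℕ
threshold Λ = 11 * Λ + 48

-- The 13 vertices are q₁, ..., q₄, the eight of `Y₁`, and p. This makes r = m - (13 + h) a true
-- difference.
fits : ∀ {Λ m} h → threshold Λ ≤ m → 8 * h ≤ m + 8 → 13 + h ≤ m
fits {Λ} {m} h M≤m 8h≤m+8 = ℕ.*-cancelˡ-≤ 8 (begin
  8 * (13 + h)        ≡⟨ ℕ.*-distribˡ-+ 8 13 h ⟩
  104 + 8 * h         ≤⟨ ℕ.+-monoʳ-≤ 104 8h≤m+8 ⟩
  104 + (m + 8)       ≡⟨ rearrange m ⟩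
  m + 112             ≤⟨ ℕ.+-monoʳ-≤ m (ℕ.m≤m+n 112 224) ⟩
  m + 7 * 48          ≤⟨ ℕ.+-monoʳ-≤ m (ℕ.*-monoʳ-≤ 7 (ℕ.≤-trans (ℕ.m≤n+m 48 (11 * Λ)) M≤m)) ⟩
  8 * m               ∎)
  where
  open ℕ.≤-Reasoning
  rearrange : ∀ m → 104 + (m + 8) ≡ m + 112
  rearrange = solve-∀

-- The left side is m + 8 Λ + 10, and 8 h ≤ m + 8 makes the right side at least 7 m / 4 - 26. So 3 m
-- ≥ 32 Λ + 144 suffices, and three times the threshold is 33 Λ + 144.
enough : ∀ {Λ m} h r → threshold Λ ≤ m → 8 * h ≤ m + 8 → m ≡ 13 + h + r →
         m + 2 * suc Λ + 2 * (2 * (2 + Λ) + Λ) ≤ 2 * suc r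
enough {Λ} {m} h r M≤m 8h≤m+8 m≡ = ℕ.*-cancelˡ-≤ 4 (ℕ.+-cancelʳ-≤ (m + 104) _ _ (begin
  4 * (m + 2 * suc Λ + 2 * (2 * (2 + Λ) + Λ)) + (m + 104)   ≤⟨ ℕ.m≤m+n _ Λ ⟩
  4 * (m + 2 * suc Λ + 2 * (2 * (2 + Λ) + Λ)) + (m + 104) + Λ ≡⟨ rearrange Λ m ⟩
  5 * m + 3 * threshold Λ                                   ≤⟨ ℕ.+-monoʳ-≤ (5 * m) (ℕ.*-monoʳ-≤ 3 M≤m) ⟩
  5 * m + 3 * m                                             ≡⟨ ℕ.*-distribʳ-+ m 5 3 ⟨
  8 * m                                                     ≡⟨ cong (8 *_) m≡ ⟩
  8 * (13 + h + r)                                          ≡⟨ rearrange′ h r ⟩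
  4 * (2 * suc r) + (8 * h + 96)                            ≤⟨ ℕ.+-monoʳ-≤ (4 * (2 * suc r)) (ℕ.+-monoˡ-≤ 96 8h≤m+8) ⟩
  4 * (2 * suc r) + (m + 8 + 96)                            ≡⟨ cong (4 * (2 * suc r) +_) (ℕ.+-assoc m 8 96) ⟩
  4 * (2 * suc r) + (m + 104)                               ∎))
  where
  open ℕ.≤-Reasoning
  rearrange : ∀ l m → 4 * (m + 2 * (1 + l) + 2 * (2 * (2 + l) + l)) + (m + 104) + l ≡ 5 * m + 3 * (11 * l + 48)
  rearrange = solve-∀
  rearrange′ : ∀ h r → 8 * (13 + h + r) ≡ 4 * (2 * (1 + r)) + (8 * h + 96)
  rearrange′ = solve-∀

module _ {n t k Λ : ℕ} (D : Design t (n C 2) k Λ) (graphical : Graphical n D) (t<k : t < k) (k<v : k < n C 2) where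

  -- For longer `Vs` a set T₀ can be built. As Λ > 0, some block contains it, and `no-block` shows
  -- that there is none.
  window-small : ∀ Vs → Unique Vs → ∣ outer Vs ∣ + 2 ≤ t → t ≤ ∣ outer Vs ∣ + suc (length Vs) →
                 length Vs < threshold Λ
  window-small Vs u o+2≤t t≤ = ℕ.≰⇒> λ M≤m →
    let h , m≤8h , 8h≤m+8 = 8*⌈m/8⌉ (length Vs)
        r  = length Vs ∸ (13 + h)
        m≡ = sym (ℕ.m+[n∸m]≡n (fits {Λ} h M≤m 8h≤m+8))
    in large (toSplit h r Vs (trans m≡ (sizes h r))) u o+2≤t t≤ m≤8h (enough h r M≤m 8h≤m+8 m≡)
    where
    sizes : ∀ h r → 13 + h + r ≡ 4 + (8 + (h + suc r))
    sizes h r = cong (12 +_) (sym (ℕ.+-suc h r))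

    large : ∀ {h r Vs} → Split h r Vs → Unique Vs → ∣ outer Vs ∣ + 2 ≤ t → t ≤ ∣ outer Vs ∣ + suc (length Vs) →
            length Vs ≤ 8 * h → length Vs + 2 * suc Λ + 2 * (2 * (2 + Λ) + Λ) ≤ 2 * suc r → ⊥
    large {h} {r} (split q₁ q₂ q₃ q₄ p Y₁ Y₂ R e₁ e₂ e₃) u o+2≤t t≤ m≤8h enough =
      let o = ∣ outer W.Vs ∣
          T , st = W.start o+2≤t (ℕ.≤-trans t≤ (ℕ.+-monoʳ-≤ o (begin
            suc (length W.Vs)            ≤⟨ s≤s m≤8h ⟩
            suc (8 * h)                  ≤⟨ ℕ.n≤1+n _ ⟩
            2 + 8 * h                    ≡⟨ cong₂ (λ i j → 2 + i * j) e₁ e₂ ⟨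
            2 + length Y₁ * length Y₂    ∎)))
          B , B∈ = nonempty (subst (0 <_) (sym (Design.balanced D (T , W.Start.size st))) (Design.Λ>0 D))
          B∈D , T⊆B = ∈-filter⁻ (λ B → T ⊆? proj₁ B) {xs = blocks D} B∈
      in W.no-block (proj₁ B) st T⊆B
           (λ T′ ∣T′∣≡t T′⊆B → twins-in-block D graphical B B∈D (T′ , ∣T′∣≡t) T′⊆B)
           (subst (t <_) (sym (proj₂ B)) t<k) (subst (_< n C 2) (sym (proj₂ B)) k<v)
           (subst (λ r → length W.Vs + 2 * suc Λ + 2 * (2 * (2 + Λ) + Λ) ≤ 2 * suc r) (sym e₃) enough)
      where
      module W = Window q₁ q₂ q₃ q₄ p Y₁ Y₂ R u
      open ℕ.≤-Reasoning

  -- The descent of `window` can start from all vertices because t ≥ 2. For the set it ends with, v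
  -- ≤ |inner Vs| + t and 2 t < v give v ≤ 2 |inner Vs|, and |inner Vs| is at most the square of
  -- |Vs|.
  nC2-bound : 2 ≤ t → t + t < n C 2 → n C 2 ≤ 2 * (threshold Λ * threshold Λ)
  nC2-bound t≥2 2t<v =
    let Vs , u , v+2≤e+t , e+t≤ = window (ℕ.<-trans t<k k<v) (allFin n) (Unique.allFin⁺ n)
          (ℕ.≤-trans (ℕ.+-monoʳ-≤ (n C 2) t≥2) (ℕ.≤-reflexive (cong (_+ t) (sym (∣inner-all∣ {n})))))
        o = ∣ outer Vs ∣
        e = ∣ inner Vs ∣
        -- Cancelling e turns the interval for e + t into o + 2 ≤ t ≤ o + |Vs| + 1, as
        -- `window-small` expects.
        v≡e+o = trans (sym (∣outer∣ Vs)) (ℕ.+-comm o e)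
        m<M = window-small Vs u
          (ℕ.+-cancelˡ-≤ e _ _ (subst (_≤ e + t) (trans (cong (_+ 2) v≡e+o) (ℕ.+-assoc e o 2)) v+2≤e+t))
          (ℕ.+-cancelˡ-≤ e _ _ (subst (e + t ≤_) (trans (cong (_+ suc (length Vs)) v≡e+o) (ℕ.+-assoc e o _)) e+t≤))
    in ℕ.+-cancelʳ-≤ (t + t) _ _ (begin
      n C 2 + (t + t)                               ≤⟨ ℕ.+-monoʳ-≤ (n C 2) (ℕ.<⇒≤ 2t<v) ⟩
      n C 2 + n C 2                                 ≤⟨ ℕ.+-mono-≤ (ℕ.m+n≤o⇒m≤o (n C 2) v+2≤e+t) (ℕ.m+n≤o⇒m≤o (n C 2) v+2≤e+t) ⟩
      e + t + (e + t)                               ≡⟨ rearrange e t ⟩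
      2 * e + (t + t)                               ≤⟨ ℕ.+-monoˡ-≤ (t + t) (ℕ.*-monoʳ-≤ 2 (ℕ.≤-trans (∣inner∣≤ Vs)
                                                         (ℕ.*-mono-≤ (ℕ.<⇒≤ m<M) (ℕ.<⇒≤ m<M)))) ⟩
      2 * (threshold Λ * threshold Λ) + (t + t)     ∎)
    where
    open ℕ.≤-Reasoning
    rearrange : ∀ e t → e + t + (e + t) ≡ 2 * e + (t + t)
    rearrange = solve-∀

-- If v ≤ t + k, the multiplicity is constant: zero contradicts nonemptiness, and a positive value
-- would give the complete design. Hence t + k < v, and t < k yields 2 t < v.
order-bound : ∀ {Λ} (D : NontrivialGraphicalDesign Λ) →
              NontrivialGraphicalDesign.n D ≤ suc (2 * (threshold Λ * threshold Λ))
order-bound {Λ} (mkNGD n t k t≥2 D graphical (t<k , k<v , ¬empty , ¬complete)) =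
  ℕ.≤-trans (n≤1+nC2 n) (s≤s (nC2-bound D graphical t<k k<v t≥2 (ℕ.≤-<-trans (ℕ.+-monoʳ-≤ t (ℕ.<⇒≤ t<k)) t+k<v)))
  where
  t+k<v : t + k < n C 2
  t+k<v = ℕ.≰⇒> λ v≤t+k → trivial (BlockCounts.μ-const t<k (blocks D) (Design.balanced D) v≤t+k)
    where
    trivial : (∃ λ c → ∀ B → μ (blocks D) B ≡ c) → ⊥
    trivial (zero  , μ≡c) = ¬empty μ≡c
    trivial (suc c , μ≡c) = ¬complete λ B → subst (1 ≤_) (sym (μ≡c B)) (s≤s z≤n)

theorem1p1 : (Λ : ℕ) → 0 < Λ →
    Σ[ Ds ∈ List (NontrivialGraphicalDesign Λ) ] IsEnumeration (nontrivialGraphicalDesigns Λ) Ds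
theorem1p1 Λ _ = enumeration Λ (suc (2 * (threshold Λ * threshold Λ))) order-bound
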